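{- Let $G=(V,E)$ be a strongly regular graph with parameters $(N,d,\alpha,\beta)$, $\beta\ge1$. Let $x\in V$, and let $A_{S_1(x)}$ be the adjacency matrix of the subgraph of $G$ induced by the set $S_1(x)$ of neighbours of $x$. Then, for any $\mathcal N\in(0,\infty]$, $$\mathcal K_{G,x}(\mathcal N)=2+\frac\alpha2-\frac{2d}{\mathcal N}+\left(\frac{2d(\beta-2)-\alpha^2}{2\beta}+\frac{2d}{\mathcal N}+\frac2\beta\min_{\lambda\in\sigma\left(A_{S_1(x)}|_{\mathbf 1^\perp}\right)}\left(\lambda-\frac\alpha2\right)^2\right)_-,$$ where the minimum is taken over all eigenvalues of $A_{S_1(x)}$ corresponding to eigenvectors in $\mathbf 1^\perp$, and $a_-:=\min\{0,a\}$ for $a\in\mathbb R$.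
   Context: For a locally finite simple graph $G=(V,E)$ and $f:V\to\mathbb R$ put $\Delta f(x)=\sum_{y\sim x}(f(y)-f(x))$ (non-normalized Laplacian), and for $f,g:V\to\mathbb R$ put $2\Gamma(f,g)=\Delta(fg)-f\Delta g-g\Delta f$, $2\Gamma_2(f,g)=\Delta\Gamma(f,g)-\Gamma(f,\Delta g)-\Gamma(\Delta f,g)$, $\Gamma(f)=\Gamma(f,f)$, $\Gamma_2(f)=\Gamma_2(f,f)$. For $\mathcal N\in(0,\infty]$ (convention $1/\infty=0$), $\mathcal K_{G,x}(\mathcal N)$ is the largest $K\in\mathbb R$ such that $\Gamma_2(f)(x)\ge\frac1{\mathcal N}(\Delta f(x))^2+K\,\Gamma(f)(x)$ for all $f:V\to\mathbb R$ (Bakry-Émery curvature function). A finite simple $d$-regular graph with $N$ vertices is strongly regular with parameters $(N,d,\alpha,\beta)$ if every two adjacent vertices have exactly $\alpha$ common neighbours and every two distinct non-adjacent vertices have exactly $\beta$ common neighbours. Complete graphs and disjoint unions of copies of a complete graph are regarded as the case $\beta=0$; it is assumed that $\beta\ge1$, so these are excluded. $\mathbf 1^\perp$ is the orthogonal complement of the all-ones vector in $\mathbb R^{S_1(x)}$; it is invariant under $A_{S_1(x)}$ since the induced subgraph on $S_1(x)$ is $\alpha$-regular. -}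

module Defs where

open import Algebra.Bundles using (CommutativeRing)
open import Algebra.Core using (Op₁; Op₂)
import Algebra.Construct.NaturalChoice.Min as NaturalMin
open import Algebra.Definitions.RawMonoid using () renaming (_×_ to multiple)
import Algebra.Properties.CommutativeMonoid.Sum as Summation
open import Data.Bool.Base using (if_then_else_)
open import Data.Fin.Base using (Fin)
open import Data.List.Base using (List; length; filter; allFin; lookup)
open import Data.Nat.Base using (ℕ)
open import Data.Product.Base using (∃; _×_)
open import Data.Vec.Functional using (Vector)
open import Level using (Level; _⊔_; 0ℓ) renaming (suc to lsuc)
open import Relation.Binary.Bundles using (DecTotalOrder)
open import Relation.Binary.Core using (Rel)
open import Relation.Binary.Definitions using (Decidable; Symmetric)
open import Relation.Binary.PropositionalEquality.Core using (_≡_; _≢_)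
open import Relation.Binary.Structures using (IsDecTotalOrder)
open import Relation.Nullary.Decidable.Core using (does; _×-dec_)
open import Relation.Nullary.Negation.Core using (¬_)
open import Relation.Unary using (Pred; Satisfiable)

-- The real numbers, given by their classical axioms: ordered field, decidable
-- total order, and a least upper bound for every inhabited bounded set.  The
-- inverse is a total operation whose value at 0# is left unspecified.

record CompleteOrderedField c ℓ₁ ℓ₂ : Set (lsuc (c ⊔ ℓ₁ ⊔ ℓ₂)) where
  infix  4 _≤_ _<_ _≉_
  infix  9 _⁻¹
  infixl 7 _/_
  infix  8 _²
  infix  9 _₋

  field
    commutativeRing : CommutativeRing c ℓ₁

  open CommutativeRing commutativeRing public hiding (_≉_)

  field
    _≤_             : Rel Carrier ℓ₂
    isDecTotalOrder : IsDecTotalOrder _≈_ _≤_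
    _⁻¹             : Op₁ Carrier

  _≉_ : Rel Carrier ℓ₁
  x ≉ y = ¬ (x ≈ y)

  _<_ : Rel Carrier (ℓ₁ ⊔ ℓ₂)
  x < y = x ≤ y × x ≉ y

  IsUpperBound : ∀ {p} → Pred Carrier p → Carrier → Set (c ⊔ ℓ₂ ⊔ p)
  IsUpperBound P b = ∀ {x} → P x → x ≤ b

  IsLowerBound : ∀ {p} → Pred Carrier p → Carrier → Set (c ⊔ ℓ₂ ⊔ p)
  IsLowerBound P b = ∀ {x} → P x → b ≤ x

  IsMaximum : ∀ {p} → Pred Carrier p → Carrier → Set (c ⊔ ℓ₂ ⊔ p)
  IsMaximum P m = P m × IsUpperBound P m

  IsMinimum : ∀ {p} → Pred Carrier p → Carrier → Set (c ⊔ ℓ₂ ⊔ p)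
  IsMinimum P m = P m × IsLowerBound P m

  field
    1≉0           : 1# ≉ 0#
    ⁻¹-inverseʳ   : ∀ {x} → x ≉ 0# → x * x ⁻¹ ≈ 1#
    +-monoˡ-≤     : ∀ z {x y} → x ≤ y → x + z ≤ y + z
    *-nonNegative : ∀ {x y} → 0# ≤ x → 0# ≤ y → 0# ≤ x * y
    supremum      : (P : Pred Carrier (c ⊔ ℓ₁ ⊔ ℓ₂)) →
                    Satisfiable P → Satisfiable (IsUpperBound P) →
                    ∃ (IsMinimum (IsUpperBound P))

  decTotalOrder : DecTotalOrder c ℓ₁ ℓ₂
  decTotalOrder = record { isDecTotalOrder = isDecTotalOrder }

  open NaturalMin (DecTotalOrder.totalOrder decTotalOrder) public using (_⊓_)
  open Summation +-commutativeMonoid public using (sum)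

  fromℕ : ℕ → Carrier
  fromℕ n = multiple +-rawMonoid n 1#

  _/_ : Op₂ Carrier
  x / y = x * y ⁻¹

  _² : Op₁ Carrier
  x ² = x * x

  _₋ : Op₁ Carrier
  a ₋ = 0# ⊓ a

record SimpleGraph (n : ℕ) : Set₁ where
  field
    Adj    : Rel (Fin n) 0ℓ
    adj?   : Decidable Adj
    symm   : Symmetric Adj
    irrefl : ∀ {u} → ¬ Adj u u

module _ {n : ℕ} (G : SimpleGraph n) where
  open SimpleGraph G

  S₁ : Fin n → List (Fin n)
  S₁ u = filter (adj? u) (allFin n)

  commonNeighbours : Fin n → Fin n → List (Fin n)
  commonNeighbours u v = filter (λ w → adj? u w ×-dec adj? v w) (allFin n)

  IsComplete : Set
  IsComplete = ∀ u v → u ≢ v → Adj u v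

  -- The i-th vertex of the induced subgraph is the i-th entry of the list,
  -- which should be free of repetitions.
  induced : (vs : List (Fin n)) → SimpleGraph (length vs)
  induced vs = record
    { Adj    = λ i j → Adj (lookup vs i) (lookup vs j)
    ; adj?   = λ i j → adj? (lookup vs i) (lookup vs j)
    ; symm   = symm
    ; irrefl = irrefl
    }

  -- In a complete graph the condition on non-adjacent pairs is void, so that
  -- it would hold for every β; by convention such a graph has β = 0.
  record IsStronglyRegular (d α β : ℕ) : Set where
    field
      regular      : ∀ u → length (S₁ u) ≡ d
      adjacent     : ∀ {u v} → Adj u v → length (commonNeighbours u v) ≡ α
      nonAdjacent  : ∀ {u v} → u ≢ v → ¬ Adj u v →
                     length (commonNeighbours u v) ≡ β
      complete⇒β≡0 : IsComplete → β ≡ 0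

module OverReals {c ℓ₁ ℓ₂ : Level} (ℝ : CompleteOrderedField c ℓ₁ ℓ₂) where
  open CompleteOrderedField ℝ

  -- (0,∞]
  data Dimension : Set (c ⊔ ℓ₁ ⊔ ℓ₂) where
    finite : (𝒩 : Carrier) → 0# < 𝒩 → Dimension
    ∞      : Dimension

  1/_ : Dimension → Carrier
  1/ finite 𝒩 _ = 𝒩 ⁻¹
  1/ ∞          = 0#

  module _ {n : ℕ} (G : SimpleGraph n) where
    open SimpleGraph G

    Δ : Vector Carrier n → Vector Carrier n
    Δ f u = sum (λ v → if does (adj? u v) then f v - f u else 0#)

    Γ : Vector Carrier n → Vector Carrier n → Vector Carrier n
    Γ f g u =
      (Δ (λ v → f v * g v) u - f u * Δ g u - g u * Δ f u) / fromℕ 2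

    Γ₂ : Vector Carrier n → Vector Carrier n → Vector Carrier n
    Γ₂ f g u = (Δ (Γ f g) u - Γ f (Δ g) u - Γ (Δ f) g u) / fromℕ 2

    CurvatureDimension : Fin n → Dimension → Pred Carrier (c ⊔ ℓ₂)
    CurvatureDimension u 𝒩 K =
      ∀ f → (1/ 𝒩) * (Δ f u) ² + K * Γ f f u ≤ Γ₂ f f u

    -- K = 𝒦_{G,u}(𝒩)
    IsBakryEmeryCurvature : Fin n → Dimension → Pred Carrier (c ⊔ ℓ₂)
    IsBakryEmeryCurvature u 𝒩 = IsMaximum (CurvatureDimension u 𝒩)

    adjacencyMatrix : Vector (Vector Carrier n) n
    adjacencyMatrix i j = if does (adj? i j) then 1# else 0#

  𝟏⊥ : ∀ {n} → Pred (Vector Carrier n) ℓ₁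
  𝟏⊥ v = sum v ≈ 0#

  -- The eigenvalues of A that have an eigenvector in W.
  σ : ∀ {n w} → Vector (Vector Carrier n) n → Pred (Vector Carrier n) w →
      Pred Carrier (c ⊔ ℓ₁ ⊔ w)
  σ A W θ = ∃ λ v → W v × (∃ λ i → v i ≉ 0#) ×
                    (∀ i → sum (λ j → A i j * v j) ≈ θ * v i)

{-# OPTIONS --safe #-}

-- Put h = f - f(x), a = h restricted to S₁(x), g = A a.  Bochner's formula and the equation
-- A² = dI + αA + β(J - I - A) give
--   4βΓ₂(f)(x) = Σ_{S₂} (βh - 2g)² + ((α+2d+4)β - 4d - α²)‖a‖² + (4-2β)(Σa)² + ‖(2A_{S₁} - α)a‖².
-- The first sum vanishes for the right choice of f on S₂(x), so only a matters.  Splitting a into its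
-- constant part and its part in 𝟏⊥, both invariant under A_{S₁}, turns the curvature into the minimum
-- of two numbers, one for each part; on 𝟏⊥ it is governed by the least value of ‖(A_{S₁} - α/2)a‖²/‖a‖².
-- That this infimum is attained at an eigenvector follows from completing squares: a quadratic form that
-- takes no nonpositive value off 0 is bounded below by a positive multiple of ‖·‖².
module Submission where

open import Defs
import Algebra.Construct.NaturalChoice.Min
import Algebra.Properties.Ring
import Algebra.Properties.Semiring.Mult
import Algebra.Properties.Semiring.Sum
import Algebra.Solver.Ring
open import Algebra.Solver.Ring.AlmostCommutativeRing using (fromCommutativeRing; _-Raw-AlmostCommutative⟶_)
open import Data.Bool.Base using (Bool; if_then_else_; true; false; _∧_)
open import Data.Fin.Base using (Fin; zero; suc)
import Data.Fin.Properties as Fin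
open import Data.Integer.Base as ℤ using (ℤ; +_; -[1+_]; _⊖_; _◃_)
import Data.Integer.Properties as ℤ
open import Data.List.Base using (List; []; _∷_; length; filter; lookup; allFin; tabulate)
open import Data.List.Membership.Propositional using (_∈_)
open import Data.List.Membership.Propositional.Properties using (∈-lookup; ∈-filter⁺; ∈-filter⁻; ∈-allFin)
import Data.List.Relation.Unary.All as All
open import Data.List.Relation.Unary.AllPairs using (_∷_)
open import Data.List.Relation.Unary.Any using (here; there)
open import Data.List.Relation.Unary.Unique.Propositional using (Unique)
import Data.List.Relation.Unary.Unique.Propositional.Properties as Unique
open import Data.Maybe.Base using (Maybe; just; nothing)
open import Data.Nat.Base as ℕ using (ℕ; zero; suc; z≤n; s≤s) renaming (_≤_ to _≤ℕ_)
import Data.Nat.Properties as ℕ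
open import Data.Product.Base using (∃; _×_; _,_; proj₁; proj₂)
import Data.Sign.Base as Sign
open import Data.Sum.Base using (_⊎_; inj₁; inj₂; [_,_]′)
open import Data.Vec.Functional as Vec using (Vector; tail)
open import Function.Base using (_∘_; id)
open import Level using (Level; _⊔_; Lift; lift)
open import Relation.Binary.Bundles using (DecTotalOrder)
open import Relation.Binary.PropositionalEquality as ≡ using (_≡_; _≢_)
import Relation.Binary.Reasoning.PartialOrder
import Relation.Binary.Reasoning.Setoid
open import Relation.Nullary using (¬_; yes; no; contradiction)
open import Relation.Nullary.Decidable using (does; _×-dec_)
open import Relation.Unary using (Pred; Decidable)

-- The reals are known only through least upper bounds, so compactness of the sphere and the
-- spectral theorem are not at hand, yet an eigenvalue attaining the minimum must be exhibited. As
-- only (λ - α/2)² is minimised, it suffices to treat C = A_{S₁} - α/2: let m be the supremum of all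
-- t with t‖v‖² ≤ ‖Cv‖² on 𝟏⊥. Were the form ‖Cv‖² - m‖v‖² definite, m could be raised; so it
-- vanishes at some v ≠ 0, which gives C²v = mv. Factoring C² - m needs √m, and this is why square
-- roots are constructed. The square over S₂(x) is completed with the term 4 Σ_{S₂} g², which is
-- absent from Bochner's formula. It can be inserted because ‖g‖² = ⟨a, A²a⟩ is again computable
-- from A²; the price is Σ_{S₁} g², which ends up in the last square. The assumption β ≥ 1 enters in
-- two ways: β is divided by, and it forces d ≥ 2, without which 𝟏⊥ would be zero and there would be
-- no eigenvalue to minimise over. The negative part in the formula expresses the minimum of the two
-- numbers as the first plus min{0, second - first}.

module OrderedField {c ℓ₁ ℓ₂ : Level} (ℝ : CompleteOrderedField c ℓ₁ ℓ₂) where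
  open CompleteOrderedField ℝ hiding (zero)
  open DecTotalOrder decTotalOrder public using (_≟_; _≤?_; total; antisym; poset; ≤-respˡ-≈; ≤-respʳ-≈)
    renaming (refl to ≤-refl; reflexive to ≤-reflexive; trans to ≤-trans)
  open Algebra.Properties.Ring ring using (-0#≈0#; -‿involutive; -‿+-comm; -‿distribˡ-*; -‿distribʳ-*)
  open Algebra.Properties.Semiring.Mult semiring using (×-homo-+; ×1-homo-*)
  module ≈-Reasoning = Relation.Binary.Reasoning.Setoid setoid
  module ≤-Reasoning = Relation.Binary.Reasoning.PartialOrder poset

  fromℤ : ℤ → Carrier
  fromℤ (+ n)    = fromℕ n
  fromℤ -[1+ n ] = - fromℕ (suc n)

  fromℤ-neg : ∀ i → fromℤ (ℤ.- i) ≈ - fromℤ i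
  fromℤ-neg (+ zero)  = sym -0#≈0#
  fromℤ-neg (+ suc n) = refl
  fromℤ-neg -[1+ n ]  = sym (-‿involutive _)

  x-0≈x : ∀ x → x - 0# ≈ x
  x-0≈x x = trans (+-congˡ -0#≈0#) (+-identityʳ x)

  fromℤ-⊖ : ∀ m n → fromℤ (m ⊖ n) ≈ fromℕ m - fromℕ n
  fromℤ-⊖ zero    zero    = sym (-‿inverseʳ 0#)
  fromℤ-⊖ (suc m) zero    = sym (x-0≈x _)
  fromℤ-⊖ zero    (suc n) = sym (+-identityˡ _)
  fromℤ-⊖ (suc m) (suc n) = begin
    fromℤ (suc m ⊖ suc n)                       ≡⟨ ≡.cong fromℤ (ℤ.[1+m]⊖[1+n]≡m⊖n m n) ⟩
    fromℤ (m ⊖ n)                               ≈⟨ fromℤ-⊖ m n ⟩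
    fromℕ m - fromℕ n                           ≈⟨ +-congʳ (x-0≈x _) ⟨
    fromℕ m - 0# - fromℕ n                      ≈⟨ +-congʳ (+-congˡ (-‿cong (-‿inverseʳ 1#))) ⟨
    fromℕ m - (1# - 1#) - fromℕ n               ≈⟨ +-congʳ (+-congˡ (-‿+-comm _ _)) ⟨
    fromℕ m + (- 1# + - - 1#) - fromℕ n         ≈⟨ +-congʳ (+-congˡ (trans (+-comm _ _) (+-congʳ (-‿involutive _)))) ⟩
    fromℕ m + (1# - 1#) - fromℕ n               ≈⟨ +-congʳ (sym (+-assoc _ _ _)) ⟩
    fromℕ m + 1# - 1# - fromℕ n                 ≈⟨ +-assoc _ _ _ ⟩
    fromℕ m + 1# + (- 1# - fromℕ n)             ≈⟨ +-cong (+-comm _ _) (-‿+-comm _ _) ⟩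
    fromℕ (suc m) - fromℕ (suc n)               ∎
    where open ≈-Reasoning

  fromℤ-+ : ∀ i j → fromℤ (i ℤ.+ j) ≈ fromℤ i + fromℤ j
  fromℤ-+ (+ m)    (+ n)    = ×-homo-+ 1# m n
  fromℤ-+ (+ m)    -[1+ n ] = fromℤ-⊖ m (suc n)
  fromℤ-+ -[1+ m ] (+ n)    = trans (fromℤ-⊖ n (suc m)) (+-comm _ _)
  fromℤ-+ -[1+ m ] -[1+ n ] = begin
    - fromℕ (suc (suc (m ℕ.+ n)))      ≡⟨ ≡.cong (λ k → - fromℕ (suc k)) (ℕ.+-suc m n) ⟨
    - fromℕ (suc m ℕ.+ suc n)          ≈⟨ -‿cong (×-homo-+ 1# (suc m) (suc n)) ⟩
    - (fromℕ (suc m) + fromℕ (suc n))  ≈⟨ -‿+-comm _ _ ⟨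
    - fromℕ (suc m) - fromℕ (suc n)    ∎
    where open ≈-Reasoning

  fromℤ-◃ : ∀ n → fromℤ (Sign.- ◃ n) ≈ - fromℕ n
  fromℤ-◃ zero    = sym -0#≈0#
  fromℤ-◃ (suc n) = refl

  fromℤ-* : ∀ i j → fromℤ (i ℤ.* j) ≈ fromℤ i * fromℤ j
  fromℤ-* (+ m) (+ n) = trans (reflexive (≡.cong fromℤ (ℤ.+◃n≡+n (m ℕ.* n)))) (×1-homo-* m n)
  fromℤ-* (+ m) -[1+ n ] = trans (fromℤ-◃ (m ℕ.* suc n))
    (trans (-‿cong (×1-homo-* m (suc n))) (-‿distribʳ-* _ _))
  fromℤ-* -[1+ m ] (+ n) = trans (fromℤ-◃ (suc m ℕ.* n))
    (trans (-‿cong (×1-homo-* (suc m) n)) (-‿distribˡ-* _ _))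
  fromℤ-* -[1+ m ] -[1+ n ] = begin
    fromℕ (suc m ℕ.* suc n)                ≈⟨ ×1-homo-* (suc m) (suc n) ⟩
    fromℕ (suc m) * fromℕ (suc n)          ≈⟨ -‿involutive _ ⟨
    - - (fromℕ (suc m) * fromℕ (suc n))    ≈⟨ -‿cong (-‿distribʳ-* _ _) ⟩
    - (fromℕ (suc m) * - fromℕ (suc n))    ≈⟨ -‿distribˡ-* _ _ ⟩
    (- fromℕ (suc m)) * - fromℕ (suc n)    ∎
    where open ≈-Reasoning

  -- Lets the ring solver compute with integer coefficients. Under it `con (+ 1)` denotes `fromℕ 1`,
  -- that is `1# + 0#`, and not `1#`; hence the many occurrences of `fromℕ 1` and the conversions by
  -- `+-identityʳ 1#` below.
  ℤ-homomorphism : ℤ.+-*-rawRing -Raw-AlmostCommutative⟶ fromCommutativeRing commutativeRing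
  ℤ-homomorphism = record
    { ⟦_⟧    = fromℤ
    ; +-homo = fromℤ-+
    ; *-homo = fromℤ-*
    ; -‿homo = fromℤ-neg
    ; 0-homo = refl
    ; 1-homo = +-identityʳ 1#
    }

  fromℤ-≟ : ∀ i j → Maybe (fromℤ i ≈ fromℤ j)
  fromℤ-≟ i j with i ℤ.≟ j
  ... | yes i≡j = just (reflexive (≡.cong fromℤ i≡j))
  ... | no  _   = nothing

  open Algebra.Solver.Ring ℤ.+-*-rawRing (fromCommutativeRing commutativeRing) ℤ-homomorphism fromℤ-≟ public
    using (solve; _:=_; _:+_; _:*_; _:-_; :-_; con)

  -- The solver proves only identities that hold in every commutative ring. To calculate under an
  -- equation p = q, a multiple of p - q with explicit cofactor `k` is added on one side, and what
  -- remains to be checked is such an identity.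
  modulo : ∀ {p q k x y} → p ≈ q → x ≈ y + k * (p - q) → x ≈ y
  modulo {p} {q} {k} {x} {y} p≈q eq = begin
    x                ≈⟨ eq ⟩
    y + k * (p - q)  ≈⟨ +-congˡ (*-congˡ (trans (+-congʳ p≈q) (-‿inverseʳ q))) ⟩
    y + k * 0#       ≈⟨ +-congˡ (zeroʳ k) ⟩
    y + 0#           ≈⟨ +-identityʳ y ⟩
    y                ∎
    where open ≈-Reasoning

  x-y≈0⇒x≈y : ∀ {x y} → x - y ≈ 0# → x ≈ y
  x-y≈0⇒x≈y {x} {y} h = modulo {k = fromℕ 1} h (solve 2 (λ x y → x := y :+ con (+ 1) :* (x :- y :- con (+ 0))) refl x y)

  x≤y⇒0≤y-x : ∀ {x y} → x ≤ y → 0# ≤ y - x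
  x≤y⇒0≤y-x {x} {y} x≤y = ≤-respˡ-≈ (-‿inverseʳ x) (+-monoˡ-≤ (- x) x≤y)

  ≤-by : ∀ {x y e} → 0# ≤ e → y ≈ x + e → x ≤ y
  ≤-by {x} {y} {e} 0≤e eq = ≤-respˡ-≈ (+-identityˡ x) (≤-respʳ-≈ (trans (+-comm e x) (sym eq)) (+-monoˡ-≤ x 0≤e))

  0≤y-x⇒x≤y : ∀ {x y} → 0# ≤ y - x → x ≤ y
  0≤y-x⇒x≤y {x} {y} h = ≤-by h (solve 2 (λ x y → y := x :+ (y :- x)) refl x y)

  infixl 6 _⊕_
  infixl 7 _⊗_

  _⊕_ : ∀ {x y} → 0# ≤ x → 0# ≤ y → 0# ≤ x + y
  p ⊕ q = ≤-trans p (≤-by q refl)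

  _⊗_ : ∀ {x y} → 0# ≤ x → 0# ≤ y → 0# ≤ x * y
  _⊗_ = *-nonNegative

  +-mono-≤ : ∀ {x y u v} → x ≤ y → u ≤ v → x + u ≤ y + v
  +-mono-≤ {x} {y} {u} {v} x≤y u≤v = ≤-by (x≤y⇒0≤y-x x≤y ⊕ x≤y⇒0≤y-x u≤v)
    (solve 4 (λ x y u v → y :+ v := x :+ u :+ (y :- x :+ (v :- u))) refl x y u v)

  *-monoˡ-≤ : ∀ {z x y} → 0# ≤ z → x ≤ y → z * x ≤ z * y
  *-monoˡ-≤ {z} {x} {y} 0≤z x≤y = ≤-by (0≤z ⊗ x≤y⇒0≤y-x x≤y)
    (solve 3 (λ z x y → z :* y := z :* x :+ z :* (y :- x)) refl z x y)

  ²-nonneg : ∀ x → 0# ≤ x ²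
  ²-nonneg x with total 0# x
  ... | inj₁ 0≤x = 0≤x ⊗ 0≤x
  ... | inj₂ x≤0 = ≤-respʳ-≈ (solve 1 (λ x → (con (+ 0) :- x) :* (con (+ 0) :- x) := x :* x) refl x)
                             (x≤y⇒0≤y-x x≤0 ⊗ x≤y⇒0≤y-x x≤0)

  0≤1 : 0# ≤ 1#
  0≤1 = ≤-respʳ-≈ (*-identityʳ 1#) (²-nonneg 1#)

  fromℕ-nonneg : ∀ n → 0# ≤ fromℕ n
  fromℕ-nonneg zero    = ≤-refl
  fromℕ-nonneg (suc n) = 0≤1 ⊕ fromℕ-nonneg n

  <⇒≤ : ∀ {x y} → x < y → x ≤ y
  <⇒≤ = proj₁

  <-≤-trans : ∀ {x y z} → x < y → y ≤ z → x < z
  <-≤-trans (x≤y , x≉y) y≤z = ≤-trans x≤y y≤z , λ x≈z → x≉y (antisym x≤y (≤-respʳ-≈ (sym x≈z) y≤z))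

  <⇒≱ : ∀ {x y} → x < y → ¬ y ≤ x
  <⇒≱ (x≤y , x≉y) y≤x = x≉y (antisym x≤y y≤x)

  ≤⊎> : ∀ x y → x ≤ y ⊎ y < x
  ≤⊎> x y with x ≤? y
  ... | yes x≤y = inj₁ x≤y
  ... | no  x≰y = inj₂ ([ (λ x≤y → contradiction x≤y x≰y) , (λ y≤x → y≤x) ]′ (total x y) , λ y≈x → x≰y (≤-reflexive (sym y≈x)))

  0<1 : 0# < 1#
  0<1 = 0≤1 , λ 0≈1 → 1≉0 (sym 0≈1)

  fromℕ-pos : ∀ n → 0# < fromℕ (suc n)
  fromℕ-pos n = <-≤-trans 0<1 (≤-by (fromℕ-nonneg n) refl)

  +-pos : ∀ {x y} → 0# < x → 0# ≤ y → 0# < x + y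
  +-pos 0<x 0≤y = <-≤-trans 0<x (≤-by 0≤y refl)

  pos⇒≉0 : ∀ {x} → 0# < x → x ≉ 0#
  pos⇒≉0 (_ , 0≉x) x≈0 = 0≉x (sym x≈0)

  pos : ∀ {x} → 0# ≤ x → x ≉ 0# → 0# < x
  pos 0≤x x≉0 = 0≤x , λ 0≈x → x≉0 (sym 0≈x)

  ⁻¹-inverseˡ : ∀ {x} → x ≉ 0# → x ⁻¹ * x ≈ 1#
  ⁻¹-inverseˡ x≉0 = trans (*-comm _ _) (⁻¹-inverseʳ x≉0)

  *-/-cancel : ∀ {x} → 0# < x → ∀ y → x * (y / x) ≈ y
  *-/-cancel {x} 0<x y = begin
    x * (y * x ⁻¹)  ≈⟨ *-congˡ (*-comm _ _) ⟩
    x * (x ⁻¹ * y)  ≈⟨ *-assoc _ _ _ ⟨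
    x * x ⁻¹ * y    ≈⟨ *-congʳ (⁻¹-inverseʳ (pos⇒≉0 0<x)) ⟩
    1# * y          ≈⟨ *-identityˡ y ⟩
    y               ∎
    where open ≈-Reasoning

  *-cancel-≉0 : ∀ {x y} → x ≉ 0# → x * y ≈ 0# → y ≈ 0#
  *-cancel-≉0 {x} {y} x≉0 xy≈0 = begin
    y               ≈⟨ *-identityˡ y ⟨
    1# * y          ≈⟨ *-congʳ (⁻¹-inverseˡ x≉0) ⟨
    x ⁻¹ * x * y    ≈⟨ *-assoc _ _ _ ⟩
    x ⁻¹ * (x * y)  ≈⟨ *-congˡ xy≈0 ⟩
    x ⁻¹ * 0#       ≈⟨ zeroʳ _ ⟩
    0#              ∎
    where open ≈-Reasoning

  *-pos : ∀ {x y} → 0# < x → 0# < y → 0# < x * y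
  *-pos 0<x 0<y = pos (<⇒≤ 0<x ⊗ <⇒≤ 0<y) λ xy≈0 → pos⇒≉0 0<y (*-cancel-≉0 (pos⇒≉0 0<x) xy≈0)

  ²≈0⇒≈0 : ∀ {x} → x ² ≈ 0# → x ≈ 0#
  ²≈0⇒≈0 {x} x²≈0 with x ≟ 0#
  ... | yes x≈0 = x≈0
  ... | no  x≉0 = *-cancel-≉0 x≉0 x²≈0

  ⁻¹-pos : ∀ {x} → 0# < x → 0# < x ⁻¹
  ⁻¹-pos {x} 0<x = pos
    -- Here x⁻¹ = x (x⁻¹)², a product of nonnegative factors.
    (≤-respʳ-≈ (trans (sym (*-assoc _ _ _)) (trans (*-congʳ inv) (*-identityˡ _))) (<⇒≤ 0<x ⊗ ²-nonneg (x ⁻¹)))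
    λ x⁻¹≈0 → 1≉0 (trans (sym inv) (trans (*-congˡ x⁻¹≈0) (zeroʳ x)))
    where inv = ⁻¹-inverseʳ (pos⇒≉0 0<x)

  0≤*-cancelˡ : ∀ {z x} → 0# < z → 0# ≤ z * x → 0# ≤ x
  0≤*-cancelˡ {z} {x} 0<z 0≤zx = ≤-respʳ-≈
    (trans (sym (*-assoc _ _ _)) (trans (*-congʳ (⁻¹-inverseˡ (pos⇒≉0 0<z))) (*-identityˡ x)))
    (<⇒≤ (⁻¹-pos 0<z) ⊗ 0≤zx)

  *-cancelˡ-≤ : ∀ {z x y} → 0# < z → z * x ≤ z * y → x ≤ y
  *-cancelˡ-≤ {z} {x} {y} 0<z zx≤zy = 0≤y-x⇒x≤y (0≤*-cancelˡ 0<z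
    (≤-respʳ-≈ (solve 3 (λ z x y → z :* y :- z :* x := z :* (y :- x)) refl z x y) (x≤y⇒0≤y-x zx≤zy)))

  ²-cancel-≤ : ∀ {x y} → 0# ≤ y → x ² ≤ y ² → x ≤ y
  ²-cancel-≤ {x} {y} 0≤y x²≤y² with ≤⊎> x y
  ... | inj₁ x≤y = x≤y
  -- The identity (x - y)² + (y² - x²) + 2y(x - y) = 0 has nonnegative summands, so x = y.
  ... | inj₂ y<x@(y≤x , y≉x) = contradiction (x-y≈0⇒x≈y (²≈0⇒≈0 (antisym
          (≤-by (x≤y⇒0≤y-x x²≤y² ⊕ ((0≤y ⊕ 0≤y) ⊗ x≤y⇒0≤y-x y≤x))
            (solve 2 (λ x y → con (+ 0) := (x :- y) :* (x :- y) :+ (y :* y :- x :* x :+ (y :+ y) :* (x :- y))) refl x y))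
          (²-nonneg _)))) λ x≈y → y≉x (sym x≈y)

  square-root : ∀ {m} → 0# ≤ m → ∃ λ s → s ² ≈ m
  square-root {m} 0≤m = s , antisym (s²≤m) m≤s²
    where
    Below = λ t → Lift (c ⊔ ℓ₁ ⊔ ℓ₂) (0# ≤ t × t ² ≤ m)

    bound : ∀ {t} → Below t → t ≤ m + fromℕ 1
    bound {t} (lift (_ , t²≤m)) = ²-cancel-≤ (0≤m ⊕ fromℕ-nonneg 1)
      (≤-trans t²≤m (≤-by (0≤m ⊗ 0≤m ⊕ 0≤m ⊕ fromℕ-nonneg 1)
        (solve 1 (λ m → (m :+ con (+ 1)) :* (m :+ con (+ 1)) := m :+ (m :* m :+ m :+ con (+ 1))) refl m)))

    sup = supremum Below (0# , lift (≤-refl , ≤-respˡ-≈ (sym (zeroˡ 0#)) 0≤m)) (m + fromℕ 1 , bound)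
    s = proj₁ sup
    upper = proj₁ (proj₂ sup)
    least = proj₂ (proj₂ sup)

    0≤s : 0# ≤ s
    0≤s = upper (lift (≤-refl , ≤-respˡ-≈ (sym (zeroˡ 0#)) 0≤m))

    m≤s² : m ≤ s ²
    m≤s² with ≤⊎> m (s ²)
    ... | inj₁ m≤s² = m≤s²
    -- If s² < m, then s + δ still has square at most m, although s bounds all such numbers.
    ... | inj₂ (s²≤m , s²≉m) = contradiction
            (upper (lift (0≤s ⊕ <⇒≤ 0<δ , 0≤y-x⇒x≤y (0≤*-cancelˡ (*-pos 0<D 0<D)
              (≤-respʳ-≈ (sym expand) (<⇒≤ 0<e ⊗ (fromℕ-nonneg 1 ⊕ (0≤s ⊕ 0≤s) ⊕ <⇒≤ 0<D ⊗ <⇒≤ 0<e)))))))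
            (<⇒≱ (≤-by (<⇒≤ 0<δ) refl , λ s≈s+δ → pos⇒≉0 0<δ (trans (solve 2 (λ s δ → δ := s :+ δ :- s) refl s δ) (trans (+-congʳ (sym s≈s+δ)) (-‿inverseʳ s)))))
      where
      e = m - s ²
      0<e : 0# < e
      0<e = pos (x≤y⇒0≤y-x s²≤m) λ e≈0 → s²≉m (sym (x-y≈0⇒x≈y e≈0))
      -- This makes δ = e/D at most 1 and at most e/(1 + 2s), so that 2sδ + δ² ≤ (2s + 1)δ ≤ e = m -
      -- s².
      D = fromℕ 1 + (s + s) + e
      0<D : 0# < D
      0<D = +-pos (+-pos (fromℕ-pos 0) (0≤s ⊕ 0≤s)) (<⇒≤ 0<e)
      δ = e / D
      0<δ : 0# < δ
      0<δ = *-pos 0<e (⁻¹-pos 0<D)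
      Dδ≈e : D * δ ≈ e
      Dδ≈e = *-/-cancel 0<D e
      expand : D * D * (m - (s + δ) ²) ≈ e * (fromℕ 1 + (s + s) + D * e)
      expand = modulo {k = - (D * (s + s) + D * δ + e)} Dδ≈e
        (solve 3 (λ m s δ → let e = m :- s :* s ; D = con (+ 1) :+ (s :+ s) :+ e in
           D :* D :* (m :- (s :+ δ) :* (s :+ δ)) :=
           e :* (con (+ 1) :+ (s :+ s) :+ D :* e) :+ (:- (D :* (s :+ s) :+ D :* δ :+ e)) :* (D :* δ :- e))
           refl m s δ)

    s²≤m : s ² ≤ m
    s²≤m with ≤⊎> (s ²) m
    ... | inj₁ s²≤m = s²≤m
    -- If m < s², then `u` is a smaller upper bound than s: u² ≥ m makes it an upper bound, and 2s(s
    -- - u) = s² - m > 0 makes it smaller.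
    ... | inj₂ (m≤s² , m≉s²) = contradiction
            (least λ {t} (lift (_ , t²≤m)) → ²-cancel-≤ 0≤u (≤-trans t²≤m m≤u²))
            (<⇒≱ (0≤y-x⇒x≤y (0≤*-cancelˡ 0<2s (≤-respʳ-≈ (sym gap) (x≤y⇒0≤y-x m≤s²)))
                 , λ u≈s → m≉s² (sym (x-y≈0⇒x≈y (trans (sym gap) (trans (*-congˡ (trans (+-congˡ (-‿cong u≈s)) (-‿inverseʳ s))) (zeroʳ _)))))))
      where
      0<s : 0# < s
      0<s = pos 0≤s λ s≈0 → m≉s² (antisym m≤s² (≤-respˡ-≈ (sym (trans (*-congʳ s≈0) (zeroˡ s))) 0≤m))
      0<2s : 0# < s + s
      0<2s = +-pos 0<s 0≤s
      -- Newton's iterate for √m.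
      u = (s ² + m) / (s + s)
      0≤u : 0# ≤ u
      0≤u = (²-nonneg s ⊕ 0≤m) ⊗ <⇒≤ (⁻¹-pos 0<2s)
      2su : (s + s) * u ≈ s ² + m
      2su = *-/-cancel 0<2s (s ² + m)
      gap : (s + s) * (s - u) ≈ s ² - m
      gap = modulo {k = - fromℕ 1} 2su
        (solve 3 (λ s u m → (s :+ s) :* (s :- u) := s :* s :- m :+ (:- con (+ 1)) :* ((s :+ s) :* u :- (s :* s :+ m))) refl s u m)
      m≤u² : m ≤ u ²
      m≤u² = 0≤y-x⇒x≤y (0≤*-cancelˡ (*-pos 0<2s 0<2s) (≤-respʳ-≈ (sym (modulo {k = (s + s) * u + (s ² + m)} 2su
        (solve 3 (λ s u m → (s :+ s) :* (s :+ s) :* (u :* u :- m) :=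
          (s :* s :- m) :* (s :* s :- m) :+ ((s :+ s) :* u :+ (s :* s :+ m)) :* ((s :+ s) :* u :- (s :* s :+ m))) refl s u m)))
        (²-nonneg (s ² - m))))

-- Finite sums and quadratic forms

module Sums {c ℓ₁ ℓ₂ : Level} (ℝ : CompleteOrderedField c ℓ₁ ℓ₂) where
  open CompleteOrderedField ℝ hiding (zero)
  open OrderedField ℝ
  open Algebra.Properties.Semiring.Sum semiring public
    using (∑-distrib-+; ∑-comm; sum-cong-≋; *-distribˡ-sum; *-distribʳ-sum; sum-replicate-zero)

  private variable n : ℕ

  dot : Vector Carrier n → Vector Carrier n → Carrier
  dot v w = sum (λ i → v i * w i)

  ‖_‖² : Vector Carrier n → Carrier
  ‖ v ‖² = dot v v

  infixr 8 _·_
  _·_ : ∀ {m} → Vector (Vector Carrier n) m → Vector Carrier n → Vector Carrier m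
  (A · v) i = dot (A i) v

  comb : Carrier → Vector Carrier n → Carrier → Vector Carrier n → Vector Carrier n
  comb a v b w i = a * v i + b * w i

  δ : Vector (Vector Carrier n) n
  δ i j = if does (i Fin.≟ j) then 1# else 0#

  sum-linear : ∀ a (v : Vector Carrier n) b w → sum (comb a v b w) ≈ a * sum v + b * sum w
  sum-linear a v b w = trans (∑-distrib-+ (λ i → a * v i) (λ i → b * w i))
    (+-cong (sym (*-distribˡ-sum a v)) (sym (*-distribˡ-sum b w)))

  sum-zero : (v : Vector Carrier n) → (∀ i → v i ≈ 0#) → sum v ≈ 0#
  sum-zero {n} v v≈0 = trans (sum-cong-≋ v≈0) (sum-replicate-zero n)

  sum-one : sum {n} (λ _ → 1#) ≈ fromℕ n
  sum-one {zero}  = refl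
  sum-one {suc n} = +-congˡ (sum-one {n})

  sum-nonneg : (v : Vector Carrier n) → (∀ i → 0# ≤ v i) → 0# ≤ sum v
  sum-nonneg {zero}  v h = ≤-refl
  sum-nonneg {suc n} v h = h zero ⊕ sum-nonneg (tail v) (λ i → h (suc i))

  term≤sum : (v : Vector Carrier n) → (∀ i → 0# ≤ v i) → ∀ i → v i ≤ sum v
  term≤sum v h zero    = ≤-by (sum-nonneg (tail v) (λ i → h (suc i))) refl
  term≤sum v h (suc i) = ≤-trans (term≤sum (tail v) (λ i → h (suc i)) i) (≤-by (h zero) (+-comm _ _))

  dot-cong : {v v′ w w′ : Vector Carrier n} → (∀ i → v i ≈ v′ i) → (∀ i → w i ≈ w′ i) → dot v w ≈ dot v′ w′
  dot-cong v≈v′ w≈w′ = sum-cong-≋ λ i → *-cong (v≈v′ i) (w≈w′ i)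

  dot-congˡ : {v w w′ : Vector Carrier n} → (∀ i → w i ≈ w′ i) → dot v w ≈ dot v w′
  dot-congˡ {v = v} = dot-cong {v = v} λ _ → refl

  dot-comm : (v w : Vector Carrier n) → dot v w ≈ dot w v
  dot-comm v w = sum-cong-≋ λ i → *-comm (v i) (w i)

  dot-combˡ : ∀ a (v : Vector Carrier n) b w u → dot (comb a v b w) u ≈ a * dot v u + b * dot w u
  dot-combˡ a v b w u = trans
    (sum-cong-≋ λ i → solve 5 (λ a v b w u → (a :* v :+ b :* w) :* u := a :* (v :* u) :+ b :* (w :* u)) refl a (v i) b (w i) (u i))
    (sum-linear a (λ i → v i * u i) b (λ i → w i * u i))

  dot-combʳ : ∀ u a (v : Vector Carrier n) b w → dot u (comb a v b w) ≈ a * dot u v + b * dot u w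
  dot-combʳ u a v b w = trans (dot-comm u _)
    (trans (dot-combˡ a v b w u) (+-cong (*-congˡ (dot-comm v u)) (*-congˡ (dot-comm w u))))

  dot-0ʳ : (v : Vector Carrier n) → dot v (λ _ → 0#) ≈ 0#
  dot-0ʳ v = sum-zero _ λ i → zeroʳ (v i)

  ‖‖²-comb : ∀ a (v : Vector Carrier n) b w →
             ‖ comb a v b w ‖² ≈ a * a * ‖ v ‖² + fromℕ 2 * (a * b) * dot v w + b * b * ‖ w ‖²
  ‖‖²-comb a v b w = begin
    ‖ comb a v b w ‖²
      ≈⟨ dot-combˡ a v b w _ ⟩
    a * dot v (comb a v b w) + b * dot w (comb a v b w)
      ≈⟨ +-cong (*-congˡ (dot-combʳ v a v b w)) (*-congˡ (trans (dot-combʳ w a v b w) (+-congʳ (*-congˡ (dot-comm w v))))) ⟩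
    a * (a * ‖ v ‖² + b * dot v w) + b * (a * dot v w + b * ‖ w ‖²)
      ≈⟨ solve 5 (λ a b p q r → a :* (a :* p :+ b :* q) :+ b :* (a :* q :+ b :* r) :=
           a :* a :* p :+ con (+ 2) :* (a :* b) :* q :+ b :* b :* r) refl a b (‖ v ‖²) (dot v w) (‖ w ‖²) ⟩
    a * a * ‖ v ‖² + fromℕ 2 * (a * b) * dot v w + b * b * ‖ w ‖² ∎
    where open ≈-Reasoning

  ‖‖²-nonneg : (v : Vector Carrier n) → 0# ≤ ‖ v ‖²
  ‖‖²-nonneg v = sum-nonneg _ λ i → ²-nonneg (v i)

  ‖‖²-pos : (v : Vector Carrier n) → ∃ (λ i → v i ≉ 0#) → 0# < ‖ v ‖²
  ‖‖²-pos v (i , vi≉0) = <-≤-trans (pos (²-nonneg (v i)) λ h → vi≉0 (²≈0⇒≈0 h)) (term≤sum _ (λ j → ²-nonneg (v j)) i)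

  ‖‖²≈0⇒≈0 : (v : Vector Carrier n) → ‖ v ‖² ≈ 0# → ∀ i → v i ≈ 0#
  ‖‖²≈0⇒≈0 v h i = ²≈0⇒≈0 (antisym (≤-respʳ-≈ h (term≤sum _ (λ j → ²-nonneg (v j)) i)) (²-nonneg (v i)))

  sum-δ : ∀ i (v : Vector Carrier n) → dot (δ i) v ≈ v i
  sum-δ zero    v = trans (+-cong (*-identityˡ _) (sum-zero (λ i → 0# * v (suc i)) λ i → zeroˡ (v (suc i)))) (+-identityʳ _)
  sum-δ (suc i) v = trans (+-cong (zeroˡ _) (sum-δ i (tail v))) (+-identityˡ _)

  -- Cauchy-Schwarz with a crude constant. Splitting off one coordinate with (x + y)² ≤ 2x² + 2y²
  -- doubles the constant each time, which is harmless since it only has to be finite.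
  dot-bound : (l : Vector Carrier n) → ∃ λ C → 0# ≤ C × ∀ v → dot l v ² ≤ C * ‖ v ‖²
  dot-bound {zero}  l = 0# , ≤-refl , λ v → ≤-refl
  dot-bound {suc n} l with dot-bound (tail l)
  ... | C , 0≤C , bound = l₀ * l₀ + l₀ * l₀ + (C + C) , (²-nonneg l₀ ⊕ ²-nonneg l₀ ⊕ (0≤C ⊕ 0≤C)) , λ v →
    ≤-by (²-nonneg (l₀ * v zero - dot (tail l) (tail v))
          ⊕ fromℕ-nonneg 2 ⊗ x≤y⇒0≤y-x (bound (tail v))
          ⊕ (²-nonneg l₀ ⊕ ²-nonneg l₀) ⊗ ‖‖²-nonneg (tail v)
          ⊕ (0≤C ⊕ 0≤C) ⊗ ²-nonneg (v zero))
      (solve 5 (λ l v D C N → (l :* l :+ l :* l :+ (C :+ C)) :* (v :* v :+ N) :=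
         (l :* v :+ D) :* (l :* v :+ D) :+
         ((l :* v :- D) :* (l :* v :- D) :+ con (+ 2) :* (C :* N :- D :* D) :+ (l :* l :+ l :* l) :* N :+ (C :+ C) :* (v :* v)))
       refl l₀ (v zero) (dot (tail l) (tail v)) C (‖ tail v ‖²))
    where l₀ = l zero

  -- pivot q l F stands for q v₀² + v₀ (l · v′) + F v′, where v = v₀ ∷ v′.
  data QuadraticForm : ℕ → Set c where
    zero  : QuadraticForm 0
    pivot : Carrier → Vector Carrier n → QuadraticForm n → QuadraticForm (suc n)

  eval : QuadraticForm n → Vector Carrier n → Carrier
  eval zero          v = 0#
  eval (pivot q l F) v = q * v zero ² + v zero * dot l (tail v) + eval F (tail v)

  zeroForm : ∀ n → QuadraticForm n
  zeroForm zero    = zero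
  zeroForm (suc n) = pivot 0# (λ _ → 0#) (zeroForm n)

  eval-zeroForm : ∀ n v → eval (zeroForm n) v ≈ 0#
  eval-zeroForm zero    v = refl
  eval-zeroForm (suc n) v = begin
    0# * v zero ² + v zero * dot (λ _ → 0#) (tail v) + eval (zeroForm n) (tail v)
      ≈⟨ +-cong (+-cong (zeroˡ _) (*-congˡ (trans (dot-comm (λ _ → 0#) (tail v)) (dot-0ʳ (tail v))))) (eval-zeroForm n (tail v)) ⟩
    0# + v zero * 0# + 0#
      ≈⟨ trans (+-identityʳ _) (trans (+-identityˡ _) (zeroʳ _)) ⟩
    0# ∎
    where open ≈-Reasoning

  eval-0 : (F : QuadraticForm n) → eval F (λ _ → 0#) ≈ 0#
  eval-0 zero          = refl
  eval-0 (pivot q l F) = begin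
    q * 0# ² + 0# * dot l (λ _ → 0#) + eval F (λ _ → 0#)  ≈⟨ +-cong (+-cong (*-congˡ (zeroˡ 0#)) (zeroˡ _)) (eval-0 F) ⟩
    q * 0# + 0# + 0#                                      ≈⟨ trans (+-identityʳ _) (trans (+-identityʳ _) (zeroʳ _)) ⟩
    0#                                                    ∎
    where open ≈-Reasoning

  -- The coefficient `κ` may be negative: completing a square subtracts one from the remaining form,
  -- and `form` below subtracts t‖·‖².
  addSquare : Carrier → Vector Carrier n → QuadraticForm n → QuadraticForm n
  addSquare κ m zero          = zero
  addSquare κ m (pivot q l F) =
    pivot (q + κ * m zero ²) (comb 1# l (fromℕ 2 * κ * m zero) (tail m)) (addSquare κ (tail m) F)

  eval-addSquare : ∀ κ m (F : QuadraticForm n) v → eval (addSquare κ m F) v ≈ eval F v + κ * dot m v ²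
  eval-addSquare κ m zero          v = sym (trans (+-identityˡ _) (trans (*-congˡ (zeroˡ 0#)) (zeroʳ κ)))
  eval-addSquare κ m (pivot q l F) v = begin
    (q + κ * m₀ ²) * v₀ ² + v₀ * dot (comb 1# l (fromℕ 2 * κ * m₀) (tail m)) (tail v) + eval (addSquare κ (tail m) F) (tail v)
      ≈⟨ +-cong (+-congˡ (*-congˡ (trans (dot-combˡ 1# l (fromℕ 2 * κ * m₀) (tail m) (tail v)) (+-congʳ (*-identityˡ _)))))
                (eval-addSquare κ (tail m) F (tail v)) ⟩
    (q + κ * m₀ ²) * v₀ ² + v₀ * (dot l (tail v) + fromℕ 2 * κ * m₀ * dot (tail m) (tail v)) + (eval F (tail v) + κ * dot (tail m) (tail v) ²)
      ≈⟨ solve 7 (λ q κ m v L M E → (q :+ κ :* (m :* m)) :* (v :* v) :+ v :* (L :+ con (+ 2) :* κ :* m :* M) :+ (E :+ κ :* (M :* M)) :=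
           q :* (v :* v) :+ v :* L :+ E :+ κ :* ((m :* v :+ M) :* (m :* v :+ M)))
         refl q κ m₀ v₀ (dot l (tail v)) (dot (tail m) (tail v)) (eval F (tail v)) ⟩
    q * v₀ ² + v₀ * dot l (tail v) + eval F (tail v) + κ * dot m v ² ∎
    where
    open ≈-Reasoning
    m₀ = m zero
    v₀ = v zero

  addSquares : ∀ {k} → Carrier → Vector (Vector Carrier n) k → QuadraticForm n → QuadraticForm n
  addSquares {k = zero}  κ M F = F
  addSquares {k = suc k} κ M F = addSquare κ (M zero) (addSquares κ (tail M) F)

  eval-addSquares : ∀ {k} κ (M : Vector (Vector Carrier n) k) F v →
                    eval (addSquares κ M F) v ≈ eval F v + κ * ‖ M · v ‖²
  eval-addSquares {k = zero}  κ M F v = sym (trans (+-congˡ (zeroʳ κ)) (+-identityʳ _))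
  eval-addSquares {k = suc k} κ M F v = begin
    eval (addSquare κ (M zero) (addSquares κ (tail M) F)) v   ≈⟨ eval-addSquare κ (M zero) (addSquares κ (tail M) F) v ⟩
    eval (addSquares κ (tail M) F) v + κ * dot (M zero) v ²   ≈⟨ +-congʳ (eval-addSquares κ (tail M) F v) ⟩
    eval F v + κ * ‖ tail M · v ‖² + κ * dot (M zero) v ²
      ≈⟨ solve 4 (λ E κ S D → E :+ κ :* S :+ κ :* D := E :+ κ :* (D :+ S)) refl (eval F v) κ (‖ tail M · v ‖²) (dot (M zero) v ²) ⟩
    eval F v + κ * ‖ M · v ‖² ∎
    where open ≈-Reasoning

  -- This takes the place of compactness of the unit sphere. Induct on the number of variables: if q
  -- ≤ 0, the first basis vector is a witness; if q > 0, completing the square in v₀ leaves a form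
  -- in the other variables, and either alternative for that form lifts.
  nonpositive-or-definite : (F : QuadraticForm n) →
    (∃ λ v → ∃ (λ i → v i ≉ 0#) × eval F v ≤ 0#) ⊎
    (∃ λ ε → 0# < ε × ∀ v → ε * ‖ v ‖² ≤ eval F v)
  nonpositive-or-definite zero = inj₂ (1# , 0<1 , λ v → ≤-reflexive (zeroʳ 1#))
  nonpositive-or-definite (pivot {n} q l F) with ≤⊎> q 0#
  ... | inj₁ q≤0 = inj₁ (1# Vec.∷ (λ _ → 0#) , (zero , 1≉0) , ≤-respˡ-≈ (sym at-e₀) q≤0)
    where
    at-e₀ : q * 1# ² + 1# * dot l (λ _ → 0#) + eval F (λ _ → 0#) ≈ q
    at-e₀ = trans (+-cong (+-cong (trans (*-congˡ (*-identityˡ 1#)) (*-identityʳ q)) (trans (*-identityˡ _) (dot-0ʳ l))) (eval-0 F))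
                  (trans (+-identityʳ _) (+-identityʳ q))
  ... | inj₂ 0<q = reduce (nonpositive-or-definite F′)
    where
    4q = fromℕ 4 * q
    0<4q : 0# < 4q
    0<4q = *-pos (fromℕ-pos 3) 0<q
    r = 4q ⁻¹
    0<r = ⁻¹-pos 0<4q
    4qr≈1 : 4q * r ≈ fromℕ 1
    4qr≈1 = trans (⁻¹-inverseʳ (pos⇒≉0 0<4q)) (sym (+-identityʳ 1#))
    -- The Schur complement of the pivot q, with r = 1/(4q).
    F′ = addSquare (- r) l F

    complete-square : ∀ v → eval (pivot q l F) v ≈ r * (fromℕ 2 * q * v zero + dot l (tail v)) ² + eval F′ (tail v)
    complete-square v = sym (trans (+-congˡ (eval-addSquare (- r) l F (tail v)))
      (modulo {k = q * v zero ² + v zero * dot l (tail v)} 4qr≈1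
        (solve 5 (λ q r v L E → r :* ((con (+ 2) :* q :* v :+ L) :* (con (+ 2) :* q :* v :+ L)) :+ (E :+ (:- r) :* (L :* L)) :=
           q :* (v :* v) :+ v :* L :+ E :+ (q :* (v :* v) :+ v :* L) :* (con (+ 4) :* q :* r :- con (+ 1)))
         refl q r (v zero) (dot l (tail v)) (eval F (tail v)))))

    reduce : (∃ λ v → ∃ (λ i → v i ≉ 0#) × eval F′ v ≤ 0#) ⊎ (∃ λ ε → 0# < ε × ∀ v → ε * ‖ v ‖² ≤ eval F′ v) →
             (∃ λ v → ∃ (λ i → v i ≉ 0#) × eval (pivot q l F) v ≤ 0#) ⊎
             (∃ λ ε → 0# < ε × ∀ v → ε * ‖ v ‖² ≤ eval (pivot q l F) v)
    reduce (inj₁ (v , (i , vi≉0) , F′v≤0)) = inj₁ (w , (suc i , vi≉0) , ≤-respˡ-≈ (sym Fw≈F′v) F′v≤0)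
      where
      L = dot l v
      -- The first coordinate solves 2q w₀ + L = 0, so that the completed square vanishes at w.
      w = (- (fromℕ 2 * r * L)) Vec.∷ v
      U≈0 : fromℕ 2 * q * w zero + L ≈ 0#
      U≈0 = modulo {k = - L} 4qr≈1
        (solve 3 (λ q r L → con (+ 2) :* q :* (:- (con (+ 2) :* r :* L)) :+ L := con (+ 0) :+ (:- L) :* (con (+ 4) :* q :* r :- con (+ 1))) refl q r L)
      Fw≈F′v : eval (pivot q l F) w ≈ eval F′ v
      Fw≈F′v = trans (complete-square w) (trans (+-congʳ (trans (*-congˡ (trans (*-congʳ U≈0) (zeroˡ _))) (zeroʳ r))) (+-identityˡ _))
    reduce (inj₂ (ε , 0<ε , F′≥)) with dot-bound l
    ... | C , 0≤C , bound = inj₂ (ε * D ⁻¹ , *-pos 0<ε (⁻¹-pos 0<D) , λ v → *-cancelˡ-≤ 0<D (main v))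
      where
      -- From v₀ = 2r(U - L) and L² ≤ C S follows ‖v‖² ≤ 8r²U² + (1 + 8r²C) S. Since εS ≤ E,
      -- comparing ε‖v‖² with rU² + E asks for a factor that is at least 8rε and at least 1 + 8r²C;
      -- `D` is their sum.
      D = fromℕ 1 + fromℕ 8 * r * r * C + fromℕ 8 * r * ε
      0<D : 0# < D
      0<D = +-pos (+-pos (fromℕ-pos 0) (fromℕ-nonneg 8 ⊗ <⇒≤ 0<r ⊗ <⇒≤ 0<r ⊗ 0≤C)) (fromℕ-nonneg 8 ⊗ <⇒≤ 0<r ⊗ <⇒≤ 0<ε)

      main : ∀ v → D * (ε * D ⁻¹ * ‖ v ‖²) ≤ D * eval (pivot q l F) v
      main v = ≤-respˡ-≈ (sym cancel) (≤-respʳ-≈ (*-congˡ (sym (complete-square v))) estimate)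
        where
        v₀ = v zero
        L = dot l (tail v)
        S = ‖ tail v ‖²
        E = eval F′ (tail v)
        U = fromℕ 2 * q * v₀ + L
        cancel : D * (ε * D ⁻¹ * ‖ v ‖²) ≈ ε * ‖ v ‖²
        cancel = trans (solve 4 (λ D ε i N → D :* (ε :* i :* N) := D :* i :* (ε :* N)) refl D ε (D ⁻¹) (‖ v ‖²))
                       (trans (*-congʳ (⁻¹-inverseʳ (pos⇒≉0 0<D))) (*-identityˡ _))
        2r[U-L]≈v₀ : fromℕ 2 * r * (U - L) ≈ v₀
        2r[U-L]≈v₀ = modulo {k = v₀} 4qr≈1 (solve 4 (λ q r v L →
          con (+ 2) :* r :* (con (+ 2) :* q :* v :+ L :- L) := v :+ v :* (con (+ 4) :* q :* r :- con (+ 1))) refl q r v₀ L)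
        0≤8rr = fromℕ-nonneg 8 ⊗ <⇒≤ 0<r ⊗ <⇒≤ 0<r
        slack = fromℕ 1 * r * U ² + fromℕ 8 * r * r * C * (r * U ²) + fromℕ 8 * r * ε * (ε * S)
                + fromℕ 8 * r * r * ε * (C * S - L ²) + fromℕ 4 * r * r * ε * (U + L) ² + D * (E - ε * S)
        0≤slack : 0# ≤ slack
        0≤slack = fromℕ-nonneg 1 ⊗ <⇒≤ 0<r ⊗ ²-nonneg U ⊕ 0≤8rr ⊗ 0≤C ⊗ (<⇒≤ 0<r ⊗ ²-nonneg U)
                ⊕ fromℕ-nonneg 8 ⊗ <⇒≤ 0<r ⊗ <⇒≤ 0<ε ⊗ (<⇒≤ 0<ε ⊗ ‖‖²-nonneg (tail v))
                ⊕ 0≤8rr ⊗ <⇒≤ 0<ε ⊗ x≤y⇒0≤y-x (bound (tail v))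
                ⊕ fromℕ-nonneg 4 ⊗ <⇒≤ 0<r ⊗ <⇒≤ 0<r ⊗ <⇒≤ 0<ε ⊗ ²-nonneg (U + L)
                ⊕ <⇒≤ 0<D ⊗ x≤y⇒0≤y-x (F′≥ (tail v))
        estimate : ε * ‖ v ‖² ≤ D * (r * U ² + E)
        estimate = ≤-by 0≤slack (trans
          (solve 7 (λ r U L C S E ε → let D = con (+ 1) :+ con (+ 8) :* r :* r :* C :+ con (+ 8) :* r :* ε in
             D :* (r :* (U :* U) :+ E) :=
             ε :* ((con (+ 2) :* r :* (U :- L)) :* (con (+ 2) :* r :* (U :- L)) :+ S) :+
             (con (+ 1) :* r :* (U :* U) :+ con (+ 8) :* r :* r :* C :* (r :* (U :* U)) :+ con (+ 8) :* r :* ε :* (ε :* S)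
              :+ con (+ 8) :* r :* r :* ε :* (C :* S :- L :* L) :+ con (+ 4) :* r :* r :* ε :* ((U :+ L) :* (U :+ L)) :+ D :* (E :- ε :* S)))
           refl r U L C S E ε)
          (+-congʳ (*-congˡ (+-congʳ (*-cong 2r[U-L]≈v₀ 2r[U-L]≈v₀)))))

-- Rayleigh quotients on 𝟏⊥

module Spectral {c ℓ₁ ℓ₂ : Level} (ℝ : CompleteOrderedField c ℓ₁ ℓ₂) where
  open CompleteOrderedField ℝ hiding (zero)
  open OverReals ℝ using (𝟏⊥)
  open OrderedField ℝ
  open Sums ℝ

  private variable n : ℕ

  IsSymmetric : Vector (Vector Carrier n) n → Set ℓ₁
  IsSymmetric A = ∀ i j → A i j ≈ A j i

  dot-1 : (v : Vector Carrier n) → dot (λ _ → 1#) v ≈ sum v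
  dot-1 v = sum-cong-≋ λ i → *-identityˡ (v i)

  self-adjoint : (A : Vector (Vector Carrier n) n) → IsSymmetric A → ∀ v w → dot (A · v) w ≈ dot v (A · w)
  self-adjoint A A-sym v w = begin
    sum (λ i → sum (λ j → A i j * v j) * w i)    ≈⟨ sum-cong-≋ (λ i → *-distribʳ-sum (w i) (λ j → A i j * v j)) ⟩
    sum (λ i → sum (λ j → A i j * v j * w i))    ≈⟨ ∑-comm (λ i j → A i j * v j * w i) ⟩
    sum (λ j → sum (λ i → A i j * v j * w i))    ≈⟨ sum-cong-≋ (λ j → sum-cong-≋ λ i → trans (*-congʳ (trans (*-comm _ _) (*-congˡ (A-sym i j)))) (*-assoc _ _ _)) ⟩
    sum (λ j → sum (λ i → v j * (A j i * w i)))  ≈⟨ sum-cong-≋ (λ j → *-distribˡ-sum (v j) (λ i → A j i * w i)) ⟨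
    sum (λ j → v j * sum (λ i → A j i * w i))    ∎
    where open ≈-Reasoning

  sum-· : (A : Vector (Vector Carrier n) n) → IsSymmetric A → ∀ {γ} → (∀ i → sum (A i) ≈ γ) → ∀ v → sum (A · v) ≈ γ * sum v
  sum-· A A-sym {γ} rows v = begin
    sum (A · v)                                ≈⟨ dot-1 (A · v) ⟨
    dot (λ _ → 1#) (A · v)                     ≈⟨ self-adjoint A A-sym (λ _ → 1#) v ⟨
    sum (λ i → dot (A i) (λ _ → 1#) * v i)     ≈⟨ sum-cong-≋ (λ i → *-congʳ (trans (dot-comm (A i) _) (trans (dot-1 (A i)) (rows i)))) ⟩
    sum (λ i → γ * v i)                        ≈⟨ *-distribˡ-sum γ v ⟨
    γ * sum v                                  ∎
    where open ≈-Reasoning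

  -- Size at least two makes 𝟏⊥ nonzero, and equal row sums of the symmetric matrix make 𝟏⊥
  -- invariant.
  module LeastSingularValue {n : ℕ} (A : Vector (Vector Carrier (suc (suc n))) (suc (suc n)))
    (A-sym : IsSymmetric A) {γ : Carrier} (rows : ∀ i → sum (A i) ≈ γ) where

    private
      V = Vector Carrier (suc (suc n))

    ·-𝟏⊥ : ∀ v → 𝟏⊥ v → 𝟏⊥ (A · v)
    ·-𝟏⊥ v Σv≈0 = trans (sum-· A A-sym rows v) (trans (*-congˡ Σv≈0) (zeroʳ γ))

    comb-𝟏⊥ : ∀ a (v : V) b w → 𝟏⊥ v → 𝟏⊥ w → 𝟏⊥ (comb a v b w)
    comb-𝟏⊥ a v b w Σv≈0 Σw≈0 = trans (sum-linear a v b w)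
      (trans (+-cong (trans (*-congˡ Σv≈0) (zeroʳ a)) (trans (*-congˡ Σw≈0) (zeroʳ b))) (+-identityˡ 0#))

    -- A linear parametrisation of 𝟏⊥ by all coordinates but the first. It turns forms on 𝟏⊥ into
    -- forms in free variables, to which `nonpositive-or-definite` applies.
    chart : Vector Carrier (suc n) → V
    chart c = (- sum c) Vec.∷ c

    chart-𝟏⊥ : ∀ c → 𝟏⊥ (chart c)
    chart-𝟏⊥ c = -‿inverseˡ (sum c)

    𝟏⊥-chart : ∀ v → 𝟏⊥ v → ∀ i → chart (tail v) i ≈ v i
    𝟏⊥-chart v Σv≈0 (suc i) = refl
    𝟏⊥-chart v Σv≈0 zero    = modulo {k = - fromℕ 1} Σv≈0
      (solve 2 (λ v₀ S → :- S := v₀ :+ (:- con (+ 1)) :* (v₀ :+ S :- con (+ 0))) refl (v zero) (sum (tail v)))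

    pullback : Vector (Vector Carrier (suc (suc n))) (suc (suc n)) → Vector (Vector Carrier (suc n)) (suc (suc n))
    pullback M i = comb 1# (tail (M i)) (- M i zero) (λ _ → 1#)

    pullback-· : ∀ M c i → (pullback M · c) i ≈ (M · chart c) i
    pullback-· M c i = begin
      dot (pullback M i) c                                          ≈⟨ dot-combˡ 1# (tail (M i)) (- M i zero) (λ _ → 1#) c ⟩
      1# * dot (tail (M i)) c + - M i zero * dot (λ _ → 1#) c       ≈⟨ +-cong (*-identityˡ _) (*-congˡ (dot-1 c)) ⟩
      dot (tail (M i)) c + - M i zero * sum c                       ≈⟨ solve 3 (λ D m S → D :+ (:- m) :* S := m :* (:- S) :+ D) refl (dot (tail (M i)) c) (M i zero) (sum c) ⟩
      M i zero * - sum c + dot (tail (M i)) c                       ∎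
      where open ≈-Reasoning

    abstract
      form : Carrier → QuadraticForm (suc n)
      form t = addSquares (- t) (pullback δ) (addSquares 1# (pullback A) (zeroForm (suc n)))

      eval-form : ∀ t c → eval (form t) c ≈ ‖ A · chart c ‖² - t * ‖ chart c ‖²
      eval-form t c = begin
        eval (form t) c
          ≈⟨ eval-addSquares (- t) (pullback δ) _ c ⟩
        eval (addSquares 1# (pullback A) (zeroForm (suc n))) c + - t * ‖ pullback δ · c ‖²
          ≈⟨ +-cong (trans (eval-addSquares 1# (pullback A) _ c) (+-cong (eval-zeroForm (suc n) c) (*-identityˡ _)))
                    (*-congˡ (dot-cong {v = pullback δ · c} δ-chart δ-chart)) ⟩
        0# + ‖ pullback A · c ‖² + - t * ‖ chart c ‖²
          ≈⟨ +-congʳ (trans (+-identityˡ _) (dot-cong {v = pullback A · c} (pullback-· A c) (pullback-· A c))) ⟩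
        ‖ A · chart c ‖² + - t * ‖ chart c ‖²
          ≈⟨ solve 3 (λ S t N → S :+ (:- t) :* N := S :- t :* N) refl (‖ A · chart c ‖²) t (‖ chart c ‖²) ⟩
        ‖ A · chart c ‖² - t * ‖ chart c ‖² ∎
        where
        open ≈-Reasoning
        δ-chart : ∀ i → (pullback δ · c) i ≈ chart c i
        δ-chart i = trans (pullback-· δ c i) (sum-δ i (chart c))

    -- The lower bounds of the Rayleigh quotient ‖Av‖²/‖v‖² on 𝟏⊥; their supremum `m` is its
    -- infimum, the square of the least singular value there.
    Below : Carrier → Set (c ⊔ ℓ₁ ⊔ ℓ₂)
    Below t = ∀ v → 𝟏⊥ v → t * ‖ v ‖² ≤ ‖ A · v ‖²

    ratio-bound : ∀ v → 𝟏⊥ v → 0# < ‖ v ‖² → ∀ {t} → Below t → t ≤ ‖ A · v ‖² / ‖ v ‖²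
    ratio-bound v v∈𝟏⊥ 0<N {t} t-below = *-cancelˡ-≤ 0<N (≤-respˡ-≈ (*-comm t (‖ v ‖²)) (≤-respʳ-≈ (sym (*-/-cancel 0<N (‖ A · v ‖²))) (t-below v v∈𝟏⊥)))

    0-below : Below 0#
    0-below v _ = ≤-respˡ-≈ (sym (zeroˡ _)) (‖‖²-nonneg (A · v))

    -- Its image (-1, 1, 0, ..., 0) under `chart` is a nonzero vector of 𝟏⊥, whose Rayleigh quotient
    -- bounds `Below` from above.
    e : Vector Carrier (suc n)
    e = 1# Vec.∷ λ _ → 0#

    abstract
      supremum-below : ∃ (IsMinimum (IsUpperBound Below))
      supremum-below = supremum Below (0# , 0-below)
        (‖ A · chart e ‖² / ‖ chart e ‖² , ratio-bound (chart e) (chart-𝟏⊥ e) (‖‖²-pos (chart e) (suc zero , 1≉0)))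

    m : Carrier
    m = proj₁ supremum-below

    m-below : Below m
    m-below v v∈𝟏⊥ with ‖ v ‖² ≟ 0#
    ... | yes N≈0 = ≤-respˡ-≈ (sym (trans (*-congˡ N≈0) (zeroʳ m))) (‖‖²-nonneg (A · v))
    ... | no  N≉0 = ≤-respʳ-≈ (*-/-cancel 0<N (‖ A · v ‖²)) (≤-respˡ-≈ (*-comm (‖ v ‖²) m)
                      (*-monoˡ-≤ (<⇒≤ 0<N) (proj₂ (proj₂ supremum-below) (ratio-bound v v∈𝟏⊥ 0<N))))
      where
      0<N : 0# < ‖ v ‖²
      0<N = pos (‖‖²-nonneg v) N≉0

    0≤m : 0# ≤ m
    0≤m = proj₁ (proj₂ supremum-below) 0-below

    -- A margin ε‖c‖² would allow m to be raised. By Cauchy-Schwarz ‖chart c‖² = (Σc)² + ‖c‖² ≤ (1 +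
    -- C)‖c‖², hence m + ε/(1 + C) would still lie in `Below`, above its supremum.
    form-not-definite : ¬ ∃ λ ε → 0# < ε × ∀ c → ε * ‖ c ‖² ≤ eval (form m) c
    form-not-definite (ε , 0<ε , definite) = <⇒≱ (≤-by (<⇒≤ 0<η) refl , λ m≈m+η → pos⇒≉0 0<η
              (trans (solve 2 (λ m η → η := m :+ η :- m) refl m η) (trans (+-congʳ (sym m≈m+η)) (-‿inverseʳ m))))
            (proj₁ (proj₂ supremum-below) m+η-below)
      where
      cauchy-schwarz = dot-bound {suc n} (λ _ → 1#)
      C = proj₁ cauchy-schwarz
      0≤C = proj₁ (proj₂ cauchy-schwarz)
      bound = proj₂ (proj₂ cauchy-schwarz)
      D = fromℕ 1 + C
      0<D : 0# < D
      0<D = +-pos (fromℕ-pos 0) 0≤C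
      η = ε / D
      0<η : 0# < η
      0<η = *-pos 0<ε (⁻¹-pos 0<D)
      Dη≈ε : D * η ≈ ε
      Dη≈ε = *-/-cancel 0<D ε

      on-chart : ∀ c → (m + η) * ‖ chart c ‖² ≤ ‖ A · chart c ‖²
      on-chart c = ≤-by (<⇒≤ 0<η ⊗ x≤y⇒0≤y-x (≤-respˡ-≈ (*-cong (dot-1 c) (dot-1 c)) (bound c)) ⊕ x≤y⇒0≤y-x (≤-respʳ-≈ (eval-form m c) (definite c)))
        (modulo {k = - ‖ c ‖²} Dη≈ε
          (solve 7 (λ m η C S N P ε → P := (m :+ η) :* ((:- S) :* (:- S) :+ N) :+
             (η :* (C :* N :- S :* S) :+ (P :- m :* ((:- S) :* (:- S) :+ N) :- ε :* N)) :+
             (:- N) :* ((con (+ 1) :+ C) :* η :- ε))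
           refl m η C (sum c) (‖ c ‖²) (‖ A · chart c ‖²) ε))

      m+η-below : Below (m + η)
      m+η-below v v∈𝟏⊥ = ≤-respˡ-≈ (*-congˡ (dot-cong {v = chart (tail v)} (𝟏⊥-chart v v∈𝟏⊥) (𝟏⊥-chart v v∈𝟏⊥)))
        (≤-respʳ-≈ (dot-cong {v = A · chart (tail v)} A-chart A-chart) (on-chart (tail v)))
        where
        A-chart : ∀ i → (A · chart (tail v)) i ≈ (A · v) i
        A-chart i = dot-congˡ {v = A i} (𝟏⊥-chart v v∈𝟏⊥)

    -- The nonnegative form ‖Av‖² - m‖v‖² on 𝟏⊥ vanishes at v, hence so does its polarization ⟨Av,Aw⟩ - m⟨v,w⟩; take w = A²v - mv.
    isotropic⇒eigen : ∀ v → 𝟏⊥ v → ‖ A · v ‖² ≤ m * ‖ v ‖² → ∀ i → (A · A · v) i ≈ m * v i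
    isotropic⇒eigen v v∈𝟏⊥ Q≤0 i = x-y≈0⇒x≈y (trans (solve 3 (λ a m v → a :- m :* v := con (+ 1) :* a :+ (:- m) :* v) refl ((A · A · v) i) m (v i))
                                     (trans (+-congʳ (*-congʳ (+-identityʳ 1#))) (‖‖²≈0⇒≈0 w (trans (sym b≈‖w‖²) b≈0) i)))
      where
      w = comb 1# (A · A · v) (- m) v
      w∈𝟏⊥ = comb-𝟏⊥ 1# (A · A · v) (- m) v (·-𝟏⊥ (A · v) (·-𝟏⊥ v v∈𝟏⊥)) v∈𝟏⊥
      b = dot (A · v) (A · w) - m * dot v w
      a = ‖ A · w ‖² - m * ‖ w ‖²
      0≤a : 0# ≤ a
      0≤a = x≤y⇒0≤y-x (m-below w w∈𝟏⊥)

      b≈‖w‖² : b ≈ ‖ w ‖²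
      b≈‖w‖² = begin
        dot (A · v) (A · w) - m * dot v w          ≈⟨ +-congʳ (self-adjoint A A-sym (A · v) w) ⟨
        dot (A · A · v) w - m * dot v w            ≈⟨ solve 3 (λ p m q → p :- m :* q := con (+ 1) :* p :+ (:- m) :* q) refl (dot (A · A · v) w) m (dot v w) ⟩
        fromℕ 1 * dot (A · A · v) w + - m * dot v w ≈⟨ +-congʳ (*-congʳ (+-identityʳ 1#)) ⟩
        1# * dot (A · A · v) w + - m * dot v w     ≈⟨ dot-combˡ 1# (A · A · v) (- m) v w ⟨
        ‖ w ‖²                                     ∎
        where open ≈-Reasoning

      u : V
      -- Write Q = ‖A·‖² - m‖·‖², so that a = Q(w) and b is the polarization of Q at v, w. Then Q(yv
      -- - bw) = y²Q(v) - b²(2y - a). The choice y = a + 1 makes the last factor a + 2 > 0, so Q(u)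
      -- ≥ 0 and Q(v) ≤ 0 force b = 0.
      u = comb (a + fromℕ 1) v (- b) w

      Qu : ‖ A · u ‖² - m * ‖ u ‖² ≈
           (a + fromℕ 1) * (a + fromℕ 1) * (‖ A · v ‖² - m * ‖ v ‖²) - b * b * (a + fromℕ 2)
      Qu = begin
        ‖ A · u ‖² - m * ‖ u ‖²
          ≈⟨ +-cong (trans (dot-cong {v = A · u} A-u A-u) (‖‖²-comb (a + fromℕ 1) (A · v) (- b) (A · w))) (-‿cong (*-congˡ (‖‖²-comb (a + fromℕ 1) v (- b) w))) ⟩
        y * y * ‖ A · v ‖² + fromℕ 2 * (y * - b) * dot (A · v) (A · w) + - b * - b * ‖ A · w ‖²
        - m * (y * y * ‖ v ‖² + fromℕ 2 * (y * - b) * dot v w + - b * - b * ‖ w ‖²)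
          ≈⟨ regroup (y * y) (fromℕ 2 * (y * - b)) (- b * - b) m (‖ A · v ‖²) (‖ v ‖²) (dot (A · v) (A · w)) (dot v w) (‖ A · w ‖²) (‖ w ‖²) ⟩
        y * y * (‖ A · v ‖² - m * ‖ v ‖²) + fromℕ 2 * (y * - b) * b + - b * - b * a
          ≈⟨ solve 3 (λ a b P → let y = a :+ con (+ 1) in
               y :* y :* P :+ con (+ 2) :* (y :* (:- b)) :* b :+ (:- b) :* (:- b) :* a := y :* y :* P :- b :* b :* (a :+ con (+ 2)))
             refl a b (‖ A · v ‖² - m * ‖ v ‖²) ⟩
        (a + fromℕ 1) * (a + fromℕ 1) * (‖ A · v ‖² - m * ‖ v ‖²) - b * b * (a + fromℕ 2) ∎
        where
        open ≈-Reasoning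
        y = a + fromℕ 1
        regroup : ∀ Y Z W m P p R r Q q → Y * P + Z * R + W * Q - m * (Y * p + Z * r + W * q) ≈
                  Y * (P - m * p) + Z * (R - m * r) + W * (Q - m * q)
        regroup = solve 10 (λ Y Z W m P p R r Q q → Y :* P :+ Z :* R :+ W :* Q :- m :* (Y :* p :+ Z :* r :+ W :* q) :=
                    Y :* (P :- m :* p) :+ Z :* (R :- m :* r) :+ W :* (Q :- m :* q)) refl
        A-u : ∀ i → (A · u) i ≈ comb (a + fromℕ 1) (A · v) (- b) (A · w) i
        A-u i = dot-combʳ (A i) (a + fromℕ 1) v (- b) w

      b²[a+2]≤0 : (a + fromℕ 2) * b ² ≤ 0#
      b²[a+2]≤0 = ≤-by (x≤y⇒0≤y-x (m-below u (comb-𝟏⊥ (a + fromℕ 1) v (- b) w v∈𝟏⊥ w∈𝟏⊥))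
                        ⊕ ²-nonneg (a + fromℕ 1) ⊗ x≤y⇒0≤y-x Q≤0)
        (trans (solve 4 (λ a b P p → con (+ 0) := (a :+ con (+ 2)) :* (b :* b) :+
            ((a :+ con (+ 1)) :* (a :+ con (+ 1)) :* (P :- p) :- b :* b :* (a :+ con (+ 2)) :+ (a :+ con (+ 1)) :* (a :+ con (+ 1)) :* (p :- P)))
            refl a b (‖ A · v ‖²) (m * ‖ v ‖²)) (+-congˡ (+-congʳ (sym Qu))))

      b≈0 : b ≈ 0#
      b≈0 = ²≈0⇒≈0 (*-cancel-≉0 (pos⇒≉0 0<a+2) (antisym b²[a+2]≤0 (<⇒≤ 0<a+2 ⊗ ²-nonneg b)))
        where
        0<a+2 : 0# < a + fromℕ 2
        0<a+2 = <-≤-trans (fromℕ-pos 1) (≤-by 0≤a (+-comm _ _))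

    minimiser : ∃ λ v → 𝟏⊥ v × ∃ (λ i → v i ≉ 0#) × ∀ i → (A · A · v) i ≈ m * v i
    minimiser with nonpositive-or-definite (form m)
    ... | inj₂ definite = contradiction definite form-not-definite
    ... | inj₁ (c , (i , cᵢ≉0) , Q≤0) = chart c , chart-𝟏⊥ c , (suc i , cᵢ≉0) ,
            isotropic⇒eigen (chart c) (chart-𝟏⊥ c)
              (0≤y-x⇒x≤y (≤-respʳ-≈ (solve 2 (λ p q → con (+ 0) :- (p :- q) := q :- p) refl (‖ A · chart c ‖²) (m * ‖ chart c ‖²))
                 (x≤y⇒0≤y-x (≤-respˡ-≈ (eval-form m c) Q≤0))))

    -- (A - s)(A + s)v = 0 when s² = m, so either v or (A + s)v is an eigenvector of A.
    least-singular-value : ∃ λ s → s ² ≈ m × ∃ λ v → 𝟏⊥ v × ∃ (λ i → v i ≉ 0#) × ∀ i → (A · v) i ≈ s * v i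
    least-singular-value with minimiser | square-root 0≤m
    ... | v , v∈𝟏⊥ , v≉0 , AAv | s , s²≈m with Fin.all? (λ i → u i ≟ 0#)
      where
      u : V
      u = comb 1# (A · v) s v
    -- Here Av = -sv; the sign does no harm, since only the square of the eigenvalue is prescribed.
    ...   | yes u≈0 = - s , trans (solve 1 (λ s → (:- s) :* (:- s) := s :* s) refl s) s²≈m , v , v∈𝟏⊥ , v≉0 , λ i →
              modulo {k = fromℕ 1} (trans (+-congʳ (*-congʳ (+-identityʳ 1#))) (u≈0 i))
                (solve 3 (λ a s v → a := (:- s) :* v :+ con (+ 1) :* (con (+ 1) :* a :+ s :* v :- con (+ 0))) refl ((A · v) i) s (v i))
    ...   | no  u≉0 = s , s²≈m , comb 1# (A · v) s v , comb-𝟏⊥ 1# (A · v) s v (·-𝟏⊥ v v∈𝟏⊥) v∈𝟏⊥ , Fin.¬∀⟶∃¬ _ _ (λ i → _ ≟ 0#) u≉0 , λ i → begin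
              dot (A i) (comb 1# (A · v) s v)          ≈⟨ dot-combʳ (A i) 1# (A · v) s v ⟩
              1# * (A · A · v) i + s * (A · v) i       ≈⟨ +-congʳ (trans (*-identityˡ _) (trans (AAv i) (*-congʳ (sym s²≈m)))) ⟩
              s * s * v i + s * (A · v) i              ≈⟨ solve 3 (λ s v a → s :* s :* v :+ s :* a := s :* (a :+ s :* v)) refl s (v i) ((A · v) i) ⟩
              s * ((A · v) i + s * v i)                ≈⟨ *-congˡ (+-congʳ (*-identityˡ _)) ⟨
              s * comb 1# (A · v) s v i                ∎
      where open ≈-Reasoning

-- The Bochner identity

module Counting {c ℓ₁ ℓ₂ : Level} (ℝ : CompleteOrderedField c ℓ₁ ℓ₂) where
  open CompleteOrderedField ℝ hiding (zero)
  open OrderedField ℝ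
  open Sums ℝ

  private variable n : ℕ

  indicator : Bool → Carrier
  indicator b = if b then 1# else 0#

  if-indicator : ∀ b x → (if b then x else 0#) ≈ indicator b * x
  if-indicator true  x = sym (*-identityˡ x)
  if-indicator false x = sym (zeroˡ x)

  indicator-idem : ∀ b → indicator b * indicator b ≈ indicator b
  indicator-idem true  = *-identityˡ 1#
  indicator-idem false = zeroˡ 0#

  indicator-∧ : ∀ b b′ → indicator (b ∧ b′) ≈ indicator b * indicator b′
  indicator-∧ true  b′ = sym (*-identityˡ _)
  indicator-∧ false b′ = sym (zeroˡ _)

  -- The bridge from sums over the induced subgraph to sums over all vertices weighted by an
  -- indicator, where the matrix identities live. A general `f` in place of the identity lets the
  -- induction close, since it passes to `f ∘ suc`.
  sum-filter : ∀ {a p} {X : Set a} {P : Pred X p} (P? : Decidable P) (f : Fin n → X) (F : X → Carrier) →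
    sum (λ i → F (lookup (filter P? (tabulate f)) i)) ≈ sum (λ j → indicator (does (P? (f j))) * F (f j))
  sum-filter {zero}  P? f F = refl
  sum-filter {suc n} P? f F with does (P? (f zero))
  ... | true  = +-cong (sym (*-identityˡ _)) (sum-filter P? (f ∘ suc) F)
  ... | false = trans (sum-filter P? (f ∘ suc) F) (trans (sym (+-identityˡ _)) (+-congʳ (sym (zeroˡ _))))

  sum-indicator : ∀ {p} {P : Pred (Fin n) p} (P? : Decidable P) →
                  sum (λ j → indicator (does (P? j))) ≈ fromℕ (length (filter P? (allFin n)))
  sum-indicator {n} P? = begin
    sum (λ j → indicator (does (P? j)))                     ≈⟨ sum-cong-≋ (λ j → *-identityʳ (indicator (does (P? j)))) ⟨
    sum (λ j → indicator (does (P? j)) * 1#)                ≈⟨ sum-filter P? id (λ _ → 1#) ⟨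
    sum {length (filter P? (allFin n))} (λ _ → 1#)          ≈⟨ sum-one {length (filter P? (allFin n))} ⟩
    fromℕ (length (filter P? (allFin n)))                   ∎
    where open ≈-Reasoning

  δ-diag : (i : Fin n) → δ i i ≈ 1#
  δ-diag i with i Fin.≟ i
  ... | yes _   = refl
  ... | no  i≢i = contradiction ≡.refl i≢i

  δ-sym : (i j : Fin n) → δ i j ≈ δ j i
  δ-sym i j with i Fin.≟ j | j Fin.≟ i
  ... | yes _ | yes _ = refl
  ... | no  _ | no  _ = refl
  ... | yes i≡j | no j≢i = contradiction (≡.sym i≡j) j≢i
  ... | no i≢j | yes j≡i = contradiction (≡.sym j≡i) i≢j

  δ-subst : (i j : Fin n) (F : Fin n → Carrier) → δ i j * F j ≈ δ i j * F i
  δ-subst i j F with i Fin.≟ j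
  ... | yes ≡.refl = refl
  ... | no  _      = trans (zeroˡ _) (sym (zeroˡ _))

  -- Carries a pointwise identity, checked by the ring solver, over to sums; when there are fewer
  -- than three summands, a coefficient `0#` fills the gap.
  sum-linear₃ : {f p q r : Vector Carrier n} {a b c : Carrier} →
    (∀ i → f i ≈ a * p i + b * q i + c * r i) → sum f ≈ a * sum p + b * sum q + c * sum r
  sum-linear₃ {f = f} {p} {q} {r} {a} {b} {c} eq = begin
    sum f                                            ≈⟨ sum-cong-≋ (λ i → trans (eq i) (+-congʳ (sym (*-identityˡ _)))) ⟩
    sum (comb 1# (comb a p b q) c r)                 ≈⟨ sum-linear 1# (comb a p b q) c r ⟩
    1# * sum (comb a p b q) + c * sum r              ≈⟨ +-congʳ (trans (*-identityˡ _) (sum-linear a p b q)) ⟩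
    a * sum p + b * sum q + c * sum r                ∎
    where open ≈-Reasoning

  sum-linear₄ : {f p q r s : Vector Carrier n} {a b c d : Carrier} →
    (∀ i → f i ≈ a * p i + b * q i + c * r i + d * s i) → sum f ≈ a * sum p + b * sum q + c * sum r + d * sum s
  sum-linear₄ {f = f} {p} {q} {r} {s} {a} {b} {c} {d} eq = begin
    sum f                                            ≈⟨ sum-cong-≋ (λ i → trans (eq i) (+-congʳ (sym (*-identityˡ _)))) ⟩
    sum (comb 1# (λ i → a * p i + b * q i + c * r i) d s)
      ≈⟨ sum-linear 1# (λ i → a * p i + b * q i + c * r i) d s ⟩
    1# * sum (λ i → a * p i + b * q i + c * r i) + d * sum s
      ≈⟨ +-congʳ (trans (*-identityˡ _) (sum-linear₃ {p = p} {q} {r} λ i → refl)) ⟩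
    a * sum p + b * sum q + c * sum r + d * sum s    ∎
    where open ≈-Reasoning

-- Strongly regular graphs: the equation for A² and Bochner's formula

module StronglyRegular {c ℓ₁ ℓ₂ : Level} (ℝ : CompleteOrderedField c ℓ₁ ℓ₂)
  {N d α β : ℕ} (G : SimpleGraph N) (srg : IsStronglyRegular G d α β) where
  open CompleteOrderedField ℝ hiding (zero)
  open OverReals ℝ
  open OrderedField ℝ
  open Sums ℝ
  open Counting ℝ
  open Spectral ℝ using (IsSymmetric; self-adjoint; dot-1)
  open SimpleGraph G
  open IsStronglyRegular srg

  A : Vector (Vector Carrier N) N
  A = adjacencyMatrix G

  dʳ = fromℕ d
  αʳ = fromℕ α
  βʳ = fromℕ β

  -- The part (α + 2d)β comes from Bochner's formula, -4(d - β) from inserting 4 Σ_{S₂} g², and -α²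
  -- from completing the square over S₁(x).
  coefficient : Carrier
  coefficient = (αʳ + fromℕ 2 * dʳ + fromℕ 4) * βʳ - fromℕ 4 * dʳ - αʳ * αʳ

  A-sym : IsSymmetric A
  A-sym u v with adj? u v | adj? v u
  ... | yes _  | yes _  = refl
  ... | no  _  | no  _  = refl
  ... | yes uv | no ¬vu = contradiction (symm uv) ¬vu
  ... | no ¬uv | yes vu = contradiction (symm vu) ¬uv

  A-diag : ∀ u → A u u ≈ 0#
  A-diag u with adj? u u
  ... | yes uu = contradiction uu irrefl
  ... | no  _  = refl

  A-idem : ∀ u v → A u v * A u v ≈ A u v
  A-idem u v = indicator-idem (does (adj? u v))

  A-adj : ∀ {u v} → Adj u v → A u v ≈ 1#
  A-adj {u} {v} uv with adj? u v
  ... | yes _  = refl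
  ... | no ¬uv = contradiction uv ¬uv

  A-rows : ∀ u → sum (A u) ≈ dʳ
  A-rows u = trans (sum-indicator (adj? u)) (reflexive (≡.cong fromℕ (regular u)))

  -- The indicator of the vertices at distance two from u.
  S₂ : Fin N → Vector Carrier N
  S₂ u v = 1# - δ u v - A u v

  S₂-cases : ∀ u v → S₂ u v ≈ 0# ⊎ (S₂ u v ≈ 1# × A u v ≈ 0#)
  S₂-cases u v with u Fin.≟ v | adj? u v
  ... | yes ≡.refl | yes uu = contradiction uu irrefl
  ... | yes _      | no  _  = inj₁ (solve 1 (λ o → o :- o :- con (+ 0) := con (+ 0)) refl 1#)
  ... | no  _      | yes _  = inj₁ (solve 1 (λ o → o :- con (+ 0) :- o := con (+ 0)) refl 1#)
  ... | no  _      | no  _  = inj₂ (solve 1 (λ o → o :- con (+ 0) :- con (+ 0) := o) refl 1# , refl)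

  common : ∀ u v → dot (A u) (A v) ≈ fromℕ (length (commonNeighbours G u v))
  common u v = trans (sum-cong-≋ λ w → sym (indicator-∧ (does (adj? u w)) (does (adj? v w))))
                     (sum-indicator (λ w → adj? u w ×-dec adj? v w))

  -- The entry counts common neighbours, by idempotence of 0 and 1: all d neighbours on the
  -- diagonal, then α or β according to adjacency.
  A² : ∀ u v → (A · A u) v ≈ dʳ * δ u v + αʳ * A u v + βʳ * S₂ u v
  A² u v with u Fin.≟ v | adj? u v
  ... | yes ≡.refl | yes uu = contradiction uu irrefl
  ... | yes ≡.refl | no  _  = trans (trans (sum-cong-≋ (A-idem u)) (A-rows u))
          (modulo {k = dʳ} (+-identityʳ 1#)
            (solve 4 (λ d α β o → d := d :* o :+ α :* con (+ 0) :+ β :* (o :- o :- con (+ 0)) :+ d :* (con (+ 1) :- o)) refl dʳ αʳ βʳ 1#))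
  ... | no u≢v | yes uv = trans (trans (dot-comm (A v) (A u)) (trans (common u v) (reflexive (≡.cong fromℕ (adjacent uv)))))
          (modulo {k = αʳ} (+-identityʳ 1#)
            (solve 4 (λ d α β o → α := d :* con (+ 0) :+ α :* o :+ β :* (o :- con (+ 0) :- o) :+ α :* (con (+ 1) :- o)) refl dʳ αʳ βʳ 1#))
  ... | no u≢v | no ¬uv = trans (trans (dot-comm (A v) (A u)) (trans (common u v) (reflexive (≡.cong fromℕ (nonAdjacent u≢v ¬uv)))))
          (modulo {k = βʳ} (+-identityʳ 1#)
            (solve 4 (λ d α β o → β := d :* con (+ 0) :+ α :* con (+ 0) :+ β :* (o :- con (+ 0) :- con (+ 0)) :+ β :* (con (+ 1) :- o)) refl dʳ αʳ βʳ 1#))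

  Δ-sum : ∀ f u → Δ G f u ≈ dot (A u) (λ v → f v - f u)
  Δ-sum f u = sum-cong-≋ λ v → if-indicator (does (adj? u v)) (f v - f u)

  -- Pointwise, fg - f(u)g(u) - f(u)(g - g(u)) - g(u)(f - f(u)) = (f - f(u))(g - g(u)). Keeping the
  -- factor 2 on the left avoids halves in all later identities.
  2Γ : ∀ f g u → fromℕ 2 * Γ G f g u ≈ sum (λ v → A u v * ((f v - f u) * (g v - g u)))
  2Γ f g u = begin
    fromℕ 2 * Γ G f g u
      ≈⟨ *-/-cancel (fromℕ-pos 1) _ ⟩
    Δ G (λ v → f v * g v) u - f u * Δ G g u - g u * Δ G f u
      ≈⟨ +-cong (+-cong (Δ-sum (λ v → f v * g v) u) (-‿cong (*-congˡ (Δ-sum g u)))) (-‿cong (*-congˡ (Δ-sum f u))) ⟩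
    dot (A u) (λ v → f v * g v - f u * g u) - f u * dot (A u) (λ v → g v - g u) - g u * dot (A u) (λ v → f v - f u)
      ≈⟨ solve 5 (λ p fu q gu r → p :- fu :* q :- gu :* r := con (+ 1) :* p :+ (:- fu) :* q :+ (:- gu) :* r) refl
           (dot (A u) (λ v → f v * g v - f u * g u)) (f u) (dot (A u) (λ v → g v - g u)) (g u) (dot (A u) (λ v → f v - f u)) ⟩
    fromℕ 1 * dot (A u) (λ v → f v * g v - f u * g u) + - f u * dot (A u) (λ v → g v - g u) + - g u * dot (A u) (λ v → f v - f u)
      ≈⟨ sum-linear₃ (λ v → solve 5 (λ a fv fu gv gu → a :* ((fv :- fu) :* (gv :- gu)) :=
           con (+ 1) :* (a :* (fv :* gv :- fu :* gu)) :+ (:- fu) :* (a :* (gv :- gu)) :+ (:- gu) :* (a :* (fv :- fu))) refl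
           (A u v) (f v) (f u) (g v) (g u)) ⟨
    sum (λ v → A u v * ((f v - f u) * (g v - g u))) ∎
    where open ≈-Reasoning

  module At (x : Fin N) (f : Vector Carrier N) where
    e t h a g : Vector Carrier N
    e = A x
    t = S₂ x
    h v = f v - f x
    a v = e v * h v
    g = A · a

    -- Sums over S₁(x) and S₂(x) written as sums over all vertices.
    S n Pag T₁ T₂ T₃ E : Carrier
    S   = sum a
    n   = sum (λ v → e v * (h v * h v))
    Pag = sum (λ v → a v * g v)
    T₁  = sum (λ v → t v * (h v * h v))
    T₂  = sum (λ v → t v * (h v * g v))
    T₃  = sum (λ v → t v * (g v * g v))
    E   = sum (λ v → e v * (g v * g v))

    hx≈0 : h x ≈ 0#
    hx≈0 = -‿inverseʳ (f x)

    Δfx : Δ G f x ≈ S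
    Δfx = Δ-sum f x

    2Γffx : fromℕ 2 * Γ G f f x ≈ n
    2Γffx = 2Γ f f x

    Δf : ∀ v → Δ G f v ≈ (A · h) v - dʳ * h v
    Δf v = begin
      Δ G f v
        ≈⟨ Δ-sum f v ⟩
      sum (λ w → A v w * (f w - f v))
        ≈⟨ sum-linear₃ {a = fromℕ 1} { - h v} {0#} (λ w → solve 4 (λ A fw fv fx → A :* (fw :- fv) :=
             con (+ 1) :* (A :* (fw :- fx)) :+ (:- (fv :- fx)) :* A :+ con (+ 0) :* A) refl (A v w) (f w) (f v) (f x)) ⟩
      fromℕ 1 * (A · h) v + - h v * sum (A v) + 0# * sum (A v)
        ≈⟨ +-congʳ (+-congˡ (*-congˡ (A-rows v))) ⟩
      fromℕ 1 * (A · h) v + - h v * dʳ + 0# * sum (A v)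
        ≈⟨ solve 4 (λ p h d q → con (+ 1) :* p :+ (:- h) :* d :+ con (+ 0) :* q := p :- d :* h) refl ((A · h) v) (h v) dʳ (sum (A v)) ⟩
      (A · h) v - dʳ * h v ∎
      where open ≈-Reasoning

    h² : Vector Carrier N
    h² v = h v * h v

    2Γff : ∀ v → fromℕ 2 * Γ G f f v ≈ (A · h²) v - fromℕ 2 * h v * (A · h) v + dʳ * h² v
    2Γff v = begin
      fromℕ 2 * Γ G f f v
        ≈⟨ 2Γ f f v ⟩
      sum (λ w → A v w * ((f w - f v) * (f w - f v)))
        ≈⟨ sum-linear₃ {a = fromℕ 1} { - (fromℕ 2 * h v)} {h² v} (λ w → solve 4 (λ A fw fv fx → let hw = fw :- fx ; hv = fv :- fx in
             A :* ((fw :- fv) :* (fw :- fv)) :=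
             con (+ 1) :* (A :* (hw :* hw)) :+ (:- (con (+ 2) :* hv)) :* (A :* hw) :+ hv :* hv :* A) refl (A v w) (f w) (f v) (f x)) ⟩
      fromℕ 1 * (A · h²) v + - (fromℕ 2 * h v) * (A · h) v + h² v * sum (A v)
        ≈⟨ +-congˡ (*-congˡ (A-rows v)) ⟩
      fromℕ 1 * (A · h²) v + - (fromℕ 2 * h v) * (A · h) v + h² v * dʳ
        ≈⟨ solve 5 (λ p h q k d → con (+ 1) :* p :+ (:- (con (+ 2) :* h)) :* q :+ k :* d := p :- con (+ 2) :* h :* q :+ d :* k) refl
             ((A · h²) v) (h v) ((A · h) v) (h² v) dʳ ⟩
      (A · h²) v - fromℕ 2 * h v * (A · h) v + dʳ * h² v ∎
      where open ≈-Reasoning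

    -- The vertices fall into {x}, S₁(x) and the rest, because `S₂` is defined so that the three
    -- indicators add up to 1.
    split : ∀ (F : Vector Carrier N) → sum F ≈ F x + sum (λ v → e v * F v) + sum (λ v → t v * F v)
    split F = begin
      sum F
        ≈⟨ sum-linear₃ {a = fromℕ 1} {fromℕ 1} {fromℕ 1} (λ v → modulo {k = F v} (+-identityʳ 1#)
             (solve 4 (λ o δ e F → F := con (+ 1) :* (δ :* F) :+ con (+ 1) :* (e :* F) :+ con (+ 1) :* ((o :- δ :- e) :* F) :+ F :* (con (+ 1) :- o))
               refl 1# (δ x v) (e v) (F v))) ⟩
      fromℕ 1 * dot (δ x) F + fromℕ 1 * sum (λ v → e v * F v) + fromℕ 1 * sum (λ v → t v * F v)
        ≈⟨ +-congʳ (+-congʳ (*-congˡ (sum-δ x F))) ⟩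
      fromℕ 1 * F x + fromℕ 1 * sum (λ v → e v * F v) + fromℕ 1 * sum (λ v → t v * F v)
        ≈⟨ solve 3 (λ p q r → con (+ 1) :* p :+ con (+ 1) :* q :+ con (+ 1) :* r := p :+ q :+ r) refl
             (F x) (sum (λ v → e v * F v)) (sum (λ v → t v * F v)) ⟩
      F x + sum (λ v → e v * F v) + sum (λ v → t v * F v) ∎
      where open ≈-Reasoning

    -- Moving A to the other side produces row x of A², which is constant on {x}, S₁(x) and S₂(x);
    -- the term at x dies because h(x) = 0.
    ⟨e,Ah²⟩ : dot e (A · h²) ≈ αʳ * n + βʳ * T₁
    ⟨e,Ah²⟩ = begin
      dot e (A · h²)
        ≈⟨ self-adjoint A A-sym e h² ⟨
      dot (A · e) h²
        ≈⟨ sum-linear₃ {p = λ v → δ x v * h² v} {λ v → e v * h² v} {λ v → t v * h² v} {dʳ} {αʳ} {βʳ} (λ v → trans (*-congʳ (A² x v))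
             (solve 7 (λ d δ α e β t h → (d :* δ :+ α :* e :+ β :* t) :* h := d :* (δ :* h) :+ α :* (e :* h) :+ β :* (t :* h)) refl
               dʳ (δ x v) αʳ (e v) βʳ (t v) (h² v))) ⟩
      dʳ * dot (δ x) h² + αʳ * n + βʳ * T₁
        ≈⟨ +-congʳ (trans (+-congʳ (trans (*-congˡ (trans (sum-δ x h²) (trans (*-congʳ hx≈0) (zeroˡ _)))) (zeroʳ dʳ))) (+-identityˡ _)) ⟩
      αʳ * n + βʳ * T₁ ∎
      where open ≈-Reasoning

    ⟨a,Ah⟩ : dot a (A · h) ≈ Pag + T₂
    ⟨a,Ah⟩ = begin
      dot a (A · h)
        ≈⟨ self-adjoint A A-sym a h ⟨
      dot g h
        ≈⟨ split (λ v → g v * h v) ⟩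
      g x * h x + sum (λ v → e v * (g v * h v)) + sum (λ v → t v * (g v * h v))
        ≈⟨ +-cong (trans (+-cong (trans (*-congˡ hx≈0) (zeroʳ (g x))) (sum-cong-≋ λ v → solve 3 (λ e g h → e :* (g :* h) := e :* h :* g) refl (e v) (g v) (h v))) (+-identityˡ _))
                  (sum-cong-≋ λ v → *-congˡ (*-comm (g v) (h v))) ⟩
      Pag + T₂ ∎
      where open ≈-Reasoning

    ‖a‖² : dot a a ≈ n
    ‖a‖² = sum-cong-≋ λ v → modulo {k = h v * h v} (A-idem x v)
      (solve 2 (λ e h → e :* h :* (e :* h) := e :* (h :* h) :+ h :* h :* (e :* e :- e)) refl (e v) (h v))

    gx≈S : g x ≈ S
    gx≈S = sum-cong-≋ λ v → trans (sym (*-assoc _ _ _)) (*-congʳ (A-idem x v))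

    A·g : ∀ v → (A · g) v ≈ dʳ * a v + αʳ * g v + βʳ * (S - a v - g v)
    A·g v = begin
      dot (A v) (A · a)
        ≈⟨ self-adjoint A A-sym (A v) a ⟨
      dot (A · A v) a
        ≈⟨ sum-linear₃ {p = λ w → δ v w * a w} {λ w → A v w * a w} {λ w → S₂ v w * a w} {dʳ} {αʳ} {βʳ} (λ w → trans (*-congʳ (A² v w))
             (solve 7 (λ d δ α e β t h → (d :* δ :+ α :* e :+ β :* t) :* h := d :* (δ :* h) :+ α :* (e :* h) :+ β :* (t :* h)) refl
               dʳ (δ v w) αʳ (A v w) βʳ (S₂ v w) (a w))) ⟩
      dʳ * dot (δ v) a + αʳ * g v + βʳ * dot (S₂ v) a
        ≈⟨ +-cong (+-congʳ (*-congˡ (sum-δ v a))) (*-congˡ S₂·a) ⟩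
      dʳ * a v + αʳ * g v + βʳ * (S - a v - g v) ∎
      where
      open ≈-Reasoning
      S₂·a : dot (S₂ v) a ≈ S - a v - g v
      S₂·a = begin
        dot (S₂ v) a
          ≈⟨ sum-linear₃ {a = fromℕ 1} { - fromℕ 1} { - fromℕ 1} (λ w → modulo {k = - a w} (+-identityʳ 1#)
               (solve 4 (λ o δ e a → (o :- δ :- e) :* a := con (+ 1) :* a :+ (:- con (+ 1)) :* (δ :* a) :+ (:- con (+ 1)) :* (e :* a) :+ (:- a) :* (con (+ 1) :- o))
                 refl 1# (δ v w) (A v w) (a w))) ⟩
        fromℕ 1 * S + - fromℕ 1 * dot (δ v) a + - fromℕ 1 * g v
          ≈⟨ +-congʳ (+-congˡ (*-congˡ (sum-δ v a))) ⟩
        fromℕ 1 * S + - fromℕ 1 * a v + - fromℕ 1 * g v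
          ≈⟨ solve 3 (λ S a g → con (+ 1) :* S :+ (:- con (+ 1)) :* a :+ (:- con (+ 1)) :* g := S :- a :- g) refl S (a v) (g v) ⟩
        S - a v - g v ∎

    -- As g = Aa, the norm is ⟨a, A²a⟩, and `A·g` evaluates A²a by the matrix equation.
    ‖g‖² : dot g g ≈ (dʳ - βʳ) * n + (αʳ - βʳ) * Pag + βʳ * S * S
    ‖g‖² = begin
      dot g g
        ≈⟨ self-adjoint A A-sym a g ⟩
      dot a (A · g)
        ≈⟨ sum-linear₃ {p = λ v → a v * a v} {λ v → a v * g v} {a} {dʳ - βʳ} {αʳ - βʳ} {βʳ * S} (λ v → trans (*-congˡ (A·g v))
             (solve 6 (λ d α β a g S → a :* (d :* a :+ α :* g :+ β :* (S :- a :- g)) := (d :- β) :* (a :* a) :+ (α :- β) :* (a :* g) :+ β :* S :* a) refl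
               dʳ αʳ βʳ (a v) (g v) S)) ⟩
      (dʳ - βʳ) * dot a a + (αʳ - βʳ) * Pag + βʳ * S * S
        ≈⟨ +-congʳ (+-congʳ (*-congˡ ‖a‖²)) ⟩
      (dʳ - βʳ) * n + (αʳ - βʳ) * Pag + βʳ * S * S ∎
      where open ≈-Reasoning

    -- What is left of ‖g‖² after removing the term at x, where g(x) = S, and the part over S₁(x).
    -- This expresses the sum needed for the square over S₂(x) by quantities that depend on a alone.
    T₃-value : T₃ ≈ (dʳ - βʳ) * n + (αʳ - βʳ) * Pag + βʳ * S * S - S * S - E
    T₃-value = begin
      T₃                             ≈⟨ solve 3 (λ s E T → T := s :+ E :+ T :- s :- E) refl (g x * g x) E T₃ ⟩
      g x * g x + E + T₃ - g x * g x - E  ≈⟨ +-congʳ (+-cong (sym (split (λ v → g v * g v))) (-‿cong (*-cong gx≈S gx≈S))) ⟩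
      dot g g - S * S - E            ≈⟨ +-congʳ (+-congʳ ‖g‖²) ⟩
      (dʳ - βʳ) * n + (αʳ - βʳ) * Pag + βʳ * S * S - S * S - E ∎
      where open ≈-Reasoning

    2ΔΓ : fromℕ 2 * Δ G (Γ G f f) x ≈ dot e (A · h²) - fromℕ 2 * dot a (A · h) + dʳ * n - n * dʳ
    2ΔΓ = begin
      fromℕ 2 * Δ G (Γ G f f) x
        ≈⟨ trans (*-congˡ (Δ-sum (Γ G f f) x)) (*-distribˡ-sum (fromℕ 2) (λ v → e v * (Γ G f f v - Γ G f f x))) ⟩
      sum (λ v → fromℕ 2 * (e v * (Γ G f f v - Γ G f f x)))
        ≈⟨ sum-linear₄ {p = λ v → e v * (A · h²) v} {λ v → a v * (A · h) v} {λ v → e v * h² v} {e} {fromℕ 1} { - fromℕ 2} {dʳ} { - n} pointwise ⟩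
      fromℕ 1 * dot e (A · h²) + - fromℕ 2 * dot a (A · h) + dʳ * n + - n * sum e
        ≈⟨ +-congˡ (*-congˡ (A-rows x)) ⟩
      fromℕ 1 * dot e (A · h²) + - fromℕ 2 * dot a (A · h) + dʳ * n + - n * dʳ
        ≈⟨ solve 4 (λ p q d n → con (+ 1) :* p :+ (:- con (+ 2)) :* q :+ d :* n :+ (:- n) :* d := p :- con (+ 2) :* q :+ d :* n :- n :* d) refl
             (dot e (A · h²)) (dot a (A · h)) dʳ n ⟩
      dot e (A · h²) - fromℕ 2 * dot a (A · h) + dʳ * n - n * dʳ ∎
      where
      open ≈-Reasoning
      pointwise : ∀ v → fromℕ 2 * (e v * (Γ G f f v - Γ G f f x)) ≈
        fromℕ 1 * (e v * (A · h²) v) + - fromℕ 2 * (a v * (A · h) v) + dʳ * (e v * h² v) + - n * e v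
      pointwise v = begin
        fromℕ 2 * (e v * (Γ G f f v - Γ G f f x))
          ≈⟨ solve 3 (λ e p q → con (+ 2) :* (e :* (p :- q)) := e :* (con (+ 2) :* p :- con (+ 2) :* q)) refl (e v) (Γ G f f v) (Γ G f f x) ⟩
        e v * (fromℕ 2 * Γ G f f v - fromℕ 2 * Γ G f f x)
          ≈⟨ *-congˡ (+-cong (2Γff v) (-‿cong 2Γffx)) ⟩
        e v * ((A · h²) v - fromℕ 2 * h v * (A · h) v + dʳ * h² v - n)
          ≈⟨ solve 7 (λ e p h q d k n → e :* (p :- con (+ 2) :* h :* q :+ d :* k :- n) :=
               con (+ 1) :* (e :* p) :+ (:- con (+ 2)) :* (e :* h :* q) :+ d :* (e :* k) :+ (:- n) :* e) refl
               (e v) ((A · h²) v) (h v) ((A · h) v) dʳ (h² v) n ⟩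
        fromℕ 1 * (e v * (A · h²) v) + - fromℕ 2 * (a v * (A · h) v) + dʳ * (e v * h² v) + - n * e v ∎

    ΓfΔf : sum (λ v → e v * ((f v - f x) * (Δ G f v - Δ G f x))) ≈ dot a (A · h) - dʳ * n - S * S
    ΓfΔf = begin
      sum (λ v → e v * (h v * (Δ G f v - Δ G f x)))
        ≈⟨ sum-linear₃ {p = λ v → a v * (A · h) v} {λ v → e v * h² v} {a} {fromℕ 1} { - dʳ} { - S} pointwise ⟩
      fromℕ 1 * dot a (A · h) + - dʳ * n + - S * S
        ≈⟨ solve 4 (λ p d n S → con (+ 1) :* p :+ (:- d) :* n :+ (:- S) :* S := p :- d :* n :- S :* S) refl (dot a (A · h)) dʳ n S ⟩
      dot a (A · h) - dʳ * n - S * S ∎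
      where
      open ≈-Reasoning
      pointwise : ∀ v → e v * (h v * (Δ G f v - Δ G f x)) ≈ fromℕ 1 * (a v * (A · h) v) + - dʳ * (e v * h² v) + - S * a v
      pointwise v = trans (*-congˡ (*-congˡ (+-cong (Δf v) (-‿cong Δfx))))
        (solve 5 (λ e h q d S → e :* (h :* (q :- d :* h :- S)) := con (+ 1) :* (e :* h :* q) :+ (:- d) :* (e :* (h :* h)) :+ (:- S) :* (e :* h)) refl
          (e v) (h v) ((A · h) v) dʳ S)

    4Γ₂ : fromℕ 4 * Γ₂ G f f x ≈ αʳ * n + βʳ * T₁ - fromℕ 4 * (Pag + T₂) + fromℕ 2 * dʳ * n + fromℕ 2 * (S * S)
    4Γ₂ = begin
      fromℕ 4 * Γ₂ G f f x
        ≈⟨ solve 1 (λ γ → con (+ 4) :* γ := con (+ 2) :* (con (+ 2) :* γ)) refl (Γ₂ G f f x) ⟩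
      fromℕ 2 * (fromℕ 2 * Γ₂ G f f x)
        ≈⟨ *-congˡ (*-/-cancel (fromℕ-pos 1) _) ⟩
      fromℕ 2 * (Δ G (Γ G f f) x - Γ G f (Δ G f) x - Γ G (Δ G f) f x)
        ≈⟨ solve 3 (λ p q r → con (+ 2) :* (p :- q :- r) := con (+ 2) :* p :- con (+ 2) :* q :- con (+ 2) :* r) refl
             (Δ G (Γ G f f) x) (Γ G f (Δ G f) x) (Γ G (Δ G f) f x) ⟩
      fromℕ 2 * Δ G (Γ G f f) x - fromℕ 2 * Γ G f (Δ G f) x - fromℕ 2 * Γ G (Δ G f) f x
        ≈⟨ +-cong (+-cong 2ΔΓ (-‿cong (trans (2Γ f (Δ G f) x) ΓfΔf)))
                  (-‿cong (trans (2Γ (Δ G f) f x) (trans (sum-cong-≋ λ v → *-congˡ {x = e v} (*-comm (Δ G f v - Δ G f x) (h v))) ΓfΔf))) ⟩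
      dot e (A · h²) - fromℕ 2 * dot a (A · h) + dʳ * n - n * dʳ - (dot a (A · h) - dʳ * n - S * S) - (dot a (A · h) - dʳ * n - S * S)
        ≈⟨ solve 5 (λ p q d n S → p :- con (+ 2) :* q :+ d :* n :- n :* d :- (q :- d :* n :- S :* S) :- (q :- d :* n :- S :* S) :=
             p :- con (+ 4) :* q :+ con (+ 2) :* d :* n :+ con (+ 2) :* (S :* S)) refl (dot e (A · h²)) (dot a (A · h)) dʳ n S ⟩
      dot e (A · h²) - fromℕ 4 * dot a (A · h) + fromℕ 2 * dʳ * n + fromℕ 2 * (S * S)
        ≈⟨ +-congʳ (+-congʳ (+-cong ⟨e,Ah²⟩ (-‿cong (*-congˡ ⟨a,Ah⟩)))) ⟩
      αʳ * n + βʳ * T₁ - fromℕ 4 * (Pag + T₂) + fromℕ 2 * dʳ * n + fromℕ 2 * (S * S) ∎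
      where open ≈-Reasoning

    R Q : Carrier
    R = sum (λ v → t v * ((βʳ * h v - fromℕ 2 * g v) * (βʳ * h v - fromℕ 2 * g v)))
    Q = sum (λ v → e v * ((fromℕ 2 * g v - αʳ * h v) * (fromℕ 2 * g v - αʳ * h v)))

    R-value : R ≈ βʳ * βʳ * T₁ + - (fromℕ 4 * βʳ) * T₂ + fromℕ 4 * T₃
    R-value = sum-linear₃ λ v → solve 4 (λ t β h g → t :* ((β :* h :- con (+ 2) :* g) :* (β :* h :- con (+ 2) :* g)) :=
      β :* β :* (t :* (h :* h)) :+ (:- (con (+ 4) :* β)) :* (t :* (h :* g)) :+ con (+ 4) :* (t :* (g :* g))) refl (t v) βʳ (h v) (g v)

    Q-value : Q ≈ αʳ * αʳ * n + - (fromℕ 4 * αʳ) * Pag + fromℕ 4 * E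
    Q-value = sum-linear₃ λ v → solve 4 (λ e α h g → e :* ((con (+ 2) :* g :- α :* h) :* (con (+ 2) :* g :- α :* h)) :=
      α :* α :* (e :* (h :* h)) :+ (:- (con (+ 4) :* α)) :* (e :* h :* g) :+ con (+ 4) :* (e :* (g :* g))) refl (e v) αʳ (h v) (g v)

    -- The values of f on S₂(x) enter only through R, which vanishes when h = (2/β) g there.
    4βΓ₂ : fromℕ 4 * βʳ * Γ₂ G f f x ≈ R + coefficient * n + (fromℕ 4 - fromℕ 2 * βʳ) * (S * S) + Q
    4βΓ₂ = begin
      fromℕ 4 * βʳ * Γ₂ G f f x
        ≈⟨ solve 2 (λ β γ → con (+ 4) :* β :* γ := β :* (con (+ 4) :* γ)) refl βʳ (Γ₂ G f f x) ⟩
      βʳ * (fromℕ 4 * Γ₂ G f f x)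
        ≈⟨ *-congˡ 4Γ₂ ⟩
      βʳ * (αʳ * n + βʳ * T₁ - fromℕ 4 * (Pag + T₂) + fromℕ 2 * dʳ * n + fromℕ 2 * (S * S))
        -- Four times the value of `T₃` is added and subtracted. With β²T₁ - 4βT₂ it forms `R`; in
        -- the rest, the terms in `Pag` and `E` together with α²n form `Q`, and the two multiples of
        -- n and S² remain.
        ≈⟨ solve 9 (λ α β d n T₁ T₂ P S E →
             β :* (α :* n :+ β :* T₁ :- con (+ 4) :* (P :+ T₂) :+ con (+ 2) :* d :* n :+ con (+ 2) :* (S :* S)) :=
             β :* β :* T₁ :+ (:- (con (+ 4) :* β)) :* T₂ :+ con (+ 4) :* ((d :- β) :* n :+ (α :- β) :* P :+ β :* S :* S :- S :* S :- E)
             :+ ((α :+ con (+ 2) :* d :+ con (+ 4)) :* β :- con (+ 4) :* d :- α :* α) :* n :+ (con (+ 4) :- con (+ 2) :* β) :* (S :* S)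
             :+ (α :* α :* n :+ (:- (con (+ 4) :* α)) :* P :+ con (+ 4) :* E)) refl αʳ βʳ dʳ n T₁ T₂ Pag S E ⟩
      βʳ * βʳ * T₁ + - (fromℕ 4 * βʳ) * T₂ + fromℕ 4 * ((dʳ - βʳ) * n + (αʳ - βʳ) * Pag + βʳ * S * S - S * S - E)
        + coefficient * n + (fromℕ 4 - fromℕ 2 * βʳ) * (S * S) + (αʳ * αʳ * n + - (fromℕ 4 * αʳ) * Pag + fromℕ 4 * E)
        ≈⟨ +-cong (+-congʳ (+-congʳ (trans (+-congˡ (*-congˡ (sym T₃-value))) (sym R-value)))) (sym Q-value) ⟩
      R + coefficient * n + (fromℕ 4 - fromℕ 2 * βʳ) * (S * S) + Q ∎
      where open ≈-Reasoning

-- Curvature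

lookup-injective : ∀ {a} {X : Set a} {xs : List X} → Unique xs → ∀ i j → lookup xs i ≡ lookup xs j → i ≡ j
lookup-injective (_ ∷ _)    zero    zero    _  = ≡.refl
lookup-injective (x∉ ∷ _)   zero    (suc j) eq = contradiction eq (All.lookup x∉ (∈-lookup j))
lookup-injective (x∉ ∷ _)   (suc i) zero    eq = contradiction (≡.sym eq) (All.lookup x∉ (∈-lookup i))
lookup-injective (_ ∷ uniq) (suc i) (suc j) eq = ≡.cong suc (lookup-injective uniq i j eq)

distinct-members⇒2≤length : ∀ {a} {X : Set a} {u v : X} {xs} → u ≢ v → u ∈ xs → v ∈ xs → 2 ℕ.≤ length xs
distinct-members⇒2≤length {xs = _ ∷ []}    u≢v (here u≡) (here v≡) = contradiction (≡.trans u≡ (≡.sym v≡)) u≢v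
distinct-members⇒2≤length {xs = _ ∷ _ ∷ _} _   _         _         = s≤s (s≤s z≤n)

head∈ : ∀ {a} {X : Set a} (xs : List X) → 1 ℕ.≤ length xs → ∃ λ w → w ∈ xs
head∈ (w ∷ _) _ = w , here ≡.refl

-- Two distinct non-adjacent vertices have a common neighbour since β ≥ 1, and that vertex has
-- degree at least 2. If there are no such vertices, the graph is complete, which the convention β =
-- 0 excludes.
2≤degree : ∀ {N d α β} (G : SimpleGraph N) → IsStronglyRegular G d α β → 1 ℕ.≤ β → 2 ℕ.≤ d
2≤degree {d = d} {β = β} G srg 1≤β with 2 ℕ.≤? d
... | yes 2≤d = 2≤d
... | no  2≰d = contradiction (≡.subst (1 ℕ.≤_) (complete⇒β≡0 complete) 1≤β) λ ()
  where
  open SimpleGraph G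
  open IsStronglyRegular srg
  complete : IsComplete G
  complete u v u≢v with adj? u v
  ... | yes uv = uv
  ... | no ¬uv with head∈ (commonNeighbours G u v) (≡.subst (1 ℕ.≤_) (≡.sym (nonAdjacent u≢v ¬uv)) 1≤β)
  ...   | w , w∈ with ∈-filter⁻ (λ w → adj? u w ×-dec adj? v w) {xs = allFin _} w∈
  ...     | _ , uw , vw = contradiction
    (≡.subst (2 ℕ.≤_) (regular w) (distinct-members⇒2≤length u≢v
      (∈-filter⁺ (adj? w) (∈-allFin u) (symm uw)) (∈-filter⁺ (adj? w) (∈-allFin v) (symm vw)))) 2≰d

-- The eigenvalue on 𝟏⊥ nearest to a given number

module ShiftedSpectrum {c ℓ₁ ℓ₂ : Level} (ℝ : CompleteOrderedField c ℓ₁ ℓ₂) where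
  open CompleteOrderedField ℝ hiding (zero)
  open OverReals ℝ
  open OrderedField ℝ
  open Sums ℝ
  open Counting ℝ
  open Spectral ℝ

  -- Shift to C = B - η, which is again symmetric with equal row sums. An eigenvalue s of C with s²
  -- = m gives the eigenvalue s + η of B, and conversely an eigenvector v of B for θ satisfies ‖Cv‖²
  -- = (θ - η)²‖v‖², so m ≤ (θ - η)².
  least-shifted-eigenvalue : ∀ {k} → 2 ℕ.≤ k → (B : Vector (Vector Carrier k) k) → IsSymmetric B →
    ∀ {γ} → (∀ i → sum (B i) ≈ γ) → ∀ η → ∃ λ m →
    IsMinimum (λ s → ∃ λ θ → σ B 𝟏⊥ θ × s ≈ (θ - η) ²) m ×
    (∀ w → 𝟏⊥ w → m * ‖ w ‖² ≤ sum (λ i → ((B · w) i - η * w i) ²))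
  least-shifted-eigenvalue {suc (suc n)} (s≤s (s≤s z≤n)) B B-sym {γ} rows η = m , (attained , lower) , bound
    where
    C : Vector (Vector Carrier (suc (suc n))) (suc (suc n))
    C i = comb (fromℕ 1) (B i) (- η) (δ i)

    C-sym : IsSymmetric C
    C-sym i j = +-cong (*-congˡ (B-sym i j)) (*-congˡ (δ-sym i j))

    C-rows : ∀ i → sum (C i) ≈ fromℕ 1 * γ + - η * sum (δ {suc (suc n)} zero)
    C-rows i = trans (sum-linear (fromℕ 1) (B i) (- η) (δ i)) (+-cong (*-congˡ (rows i)) (*-congˡ (trans (δ-row i) (sym (δ-row zero)))))
      where
      δ-row : ∀ i → sum (δ {suc (suc n)} i) ≈ 1#
      δ-row i = trans (sum-cong-≋ {x = δ i} {λ j → δ i j * 1#} λ j → sym (*-identityʳ (δ i j))) (sum-δ i (λ _ → 1#))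

    C· : ∀ w i → (C · w) i ≈ (B · w) i - η * w i
    C· w i = begin
      dot (C i) w                               ≈⟨ dot-combˡ (fromℕ 1) (B i) (- η) (δ i) w ⟩
      fromℕ 1 * (B · w) i + - η * dot (δ i) w   ≈⟨ +-congˡ (*-congˡ (sum-δ i w)) ⟩
      fromℕ 1 * (B · w) i + - η * w i           ≈⟨ solve 3 (λ b η w → con (+ 1) :* b :+ (:- η) :* w := b :- η :* w) refl ((B · w) i) η (w i) ⟩
      (B · w) i - η * w i                       ∎
      where open ≈-Reasoning

    open LeastSingularValue C C-sym C-rows using (m; m-below; least-singular-value)

    bound : ∀ w → 𝟏⊥ w → m * ‖ w ‖² ≤ sum (λ i → ((B · w) i - η * w i) ²)
    bound w w∈𝟏⊥ = ≤-respʳ-≈ (sum-cong-≋ λ i → *-cong (C· w i) (C· w i)) (m-below w w∈𝟏⊥)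

    attained : ∃ λ θ → σ B 𝟏⊥ θ × m ≈ (θ - η) ²
    attained =
      let s , s²≈m , v , v∈𝟏⊥ , v≉0 , Cv≈sv = least-singular-value
      in s + η
       , (v , v∈𝟏⊥ , v≉0 , λ i → modulo {k = fromℕ 1} (trans (sym (C· v i)) (Cv≈sv i))
            (solve 4 (λ b s η v → b := (s :+ η) :* v :+ con (+ 1) :* (b :- η :* v :- s :* v)) refl ((B · v) i) s η (v i)))
       , trans (sym s²≈m) (solve 2 (λ s η → s :* s := (s :+ η :- η) :* (s :+ η :- η)) refl s η)

    lower : ∀ {s} → (∃ λ θ → σ B 𝟏⊥ θ × s ≈ (θ - η) ²) → m ≤ s
    lower {s} (θ , (v , v∈𝟏⊥ , v≉0 , Bv≈θv) , s≈) = ≤-respʳ-≈ (sym s≈)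
      (*-cancelˡ-≤ (‖‖²-pos v v≉0) (≤-respˡ-≈ (*-comm m (‖ v ‖²)) (≤-respʳ-≈ at-v (bound v v∈𝟏⊥))))
      where
      at-v : sum (λ i → ((B · v) i - η * v i) ²) ≈ ‖ v ‖² * (θ - η) ²
      at-v = trans (sum-cong-≋ λ i → trans (*-cong (+-congʳ (Bv≈θv i)) (+-congʳ (Bv≈θv i)))
                     (solve 3 (λ θ η v → (θ :* v :- η :* v) :* (θ :* v :- η :* v) := v :* v :* ((θ :- η) :* (θ :- η))) refl θ η (v i)))
                   (sym (*-distribʳ-sum ((θ - η) ²) (λ i → v i * v i)))

-- Curvature at a vertex through the graph induced on its neighbours

module Neighbourhood {c ℓ₁ ℓ₂ : Level} (ℝ : CompleteOrderedField c ℓ₁ ℓ₂)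
  {N d α β : ℕ} (G : SimpleGraph N) (srg : IsStronglyRegular G d α β) (x : Fin N) where
  open CompleteOrderedField ℝ hiding (zero)
  open OverReals ℝ
  open OrderedField ℝ
  open Sums ℝ
  open Counting ℝ
  open Spectral ℝ
  open SimpleGraph G
  open IsStronglyRegular srg
  open StronglyRegular ℝ G srg

  k : ℕ
  k = length (S₁ G x)

  p : Fin k → Fin N
  p = lookup (S₁ G x)

  B : Vector (Vector Carrier k) k
  B = adjacencyMatrix (induced G (S₁ G x))

  p-adj : ∀ i → Adj x (p i)
  p-adj i = proj₂ (∈-filter⁻ (adj? x) {xs = allFin N} (∈-lookup {xs = S₁ G x} i))

  p-injective : ∀ i j → p i ≡ p j → i ≡ j
  p-injective = lookup-injective (Unique.filter⁺ (adj? x) (Unique.allFin⁺ N))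

  sum-neighbours : (F : Vector Carrier N) → sum (λ i → F (p i)) ≈ sum (λ v → A x v * F v)
  sum-neighbours F = sum-filter (adj? x) id F

  B-sym : IsSymmetric B
  B-sym i j = A-sym (p i) (p j)

  -- The neighbours of `p i` within S₁(x) are its common neighbours with x.
  B-rows : ∀ i → sum (B i) ≈ αʳ
  B-rows i = trans (sum-neighbours (A (p i))) (trans (common x (p i)) (reflexive (≡.cong fromℕ (adjacent (p-adj i)))))

  fromℕ-k : fromℕ k ≈ dʳ
  fromℕ-k = reflexive (≡.cong fromℕ (regular x))

  energy : Vector Carrier k → Carrier
  energy v = sum (λ i → (fromℕ 2 * (B · v) i - αʳ * v i) ²)

  module Restriction (f : Vector Carrier N) where
    open At x f using (h; R; g)

    v : Vector Carrier k
    v i = h (p i)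

    Δfx : Δ G f x ≈ sum v
    Δfx = trans (At.Δfx x f) (sym (sum-neighbours h))

    2Γffx : fromℕ 2 * Γ G f f x ≈ ‖ v ‖²
    2Γffx = trans (At.2Γffx x f) (sym (sum-neighbours λ w → h w * h w))

    B·v : ∀ i → g (p i) ≈ (B · v) i
    B·v i = trans (sum-cong-≋ λ w → solve 3 (λ a e h → a :* (e :* h) := e :* (a :* h)) refl (A (p i) w) (A x w) (h w))
                  (sym (sum-neighbours λ w → A (p i) w * h w))

    Q≈energy : At.Q x f ≈ energy v
    Q≈energy = trans (sym (sum-neighbours λ w → (fromℕ 2 * g w - αʳ * h w) ²))
                     (sum-cong-≋ λ i → *-cong (+-congʳ (*-congˡ (B·v i))) (+-congʳ (*-congˡ (B·v i))))

    4βΓ₂ : fromℕ 4 * βʳ * Γ₂ G f f x ≈ R + coefficient * ‖ v ‖² + (fromℕ 4 - fromℕ 2 * βʳ) * sum v ² + energy v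
    4βΓ₂ = trans (At.4βΓ₂ x f) (+-cong (+-cong (+-congˡ (*-congˡ (sym (sum-neighbours λ w → h w * h w))))
             (*-congˡ (*-cong (sym (sum-neighbours h)) (sym (sum-neighbours h))))) Q≈energy)

    0≤R : 0# ≤ R
    0≤R = sum-nonneg _ λ w → S₂-nonneg w ⊗ ²-nonneg (βʳ * h w - fromℕ 2 * g w)
      where
      S₂-nonneg : ∀ w → 0# ≤ S₂ x w
      S₂-nonneg w with S₂-cases x w
      ... | inj₁ ≈0       = ≤-reflexive (sym ≈0)
      ... | inj₂ (≈1 , _) = ≤-respʳ-≈ (sym ≈1) 0≤1

  -- The optimal extension of data on S₁(x): zero at x, and (2/β) A a₀ on S₂(x), where a₀ is the
  -- extension by zero. These values annihilate each summand of `R`, so Γ₂ becomes a function of `v`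
  -- alone.
  module Extension (0<β : 0# < βʳ) (v : Vector Carrier k) where
    a₀ f : Vector Carrier N
    a₀ u = sum (λ i → δ (p i) u * v i)
    f  u = a₀ u + S₂ x u * (fromℕ 2 / βʳ * (A · a₀) u)

    open At x f using (h; a; g; R)

    a₀-p : ∀ j → a₀ (p j) ≈ v j
    a₀-p j = trans (sum-cong-≋ λ i → *-congʳ (δ-p i)) (sum-δ j v)
      where
      δ-p : ∀ i → δ (p i) (p j) ≈ δ j i
      δ-p i with p i Fin.≟ p j | j Fin.≟ i
      ... | yes _     | yes _   = refl
      ... | no  _     | no  _   = refl
      ... | yes pi≡pj | no j≢i  = contradiction (≡.sym (p-injective i j pi≡pj)) j≢i
      ... | no pi≢pj  | yes j≡i = contradiction (≡.cong p (≡.sym j≡i)) pi≢pj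

    e*a₀ : ∀ u → A x u * a₀ u ≈ a₀ u
    e*a₀ u = trans (*-distribˡ-sum (A x u) (λ i → δ (p i) u * v i)) (sum-cong-≋ λ i → begin
      A x u * (δ (p i) u * v i)      ≈⟨ solve 3 (λ e δ v → e :* (δ :* v) := δ :* e :* v) refl (A x u) (δ (p i) u) (v i) ⟩
      δ (p i) u * A x u * v i        ≈⟨ *-congʳ (δ-subst (p i) u (A x)) ⟩
      δ (p i) u * A x (p i) * v i    ≈⟨ *-congʳ (trans (*-congˡ (A-adj (p-adj i))) (*-identityʳ _)) ⟩
      δ (p i) u * v i                ∎)
      where open ≈-Reasoning

    f-outside-S₂ : ∀ u → S₂ x u ≈ 0# → f u ≈ a₀ u
    f-outside-S₂ u t≈0 = trans (+-congˡ (trans (*-congʳ t≈0) (zeroˡ _))) (+-identityʳ _)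

    S₂-self : S₂ x x ≈ 0#
    S₂-self = trans (+-cong (+-congˡ (-‿cong (δ-diag x))) (-‿cong (A-diag x))) (solve 1 (λ o → o :- o :- con (+ 0) := con (+ 0)) refl 1#)

    a₀-off : ∀ u → A x u ≈ 0# → a₀ u ≈ 0#
    a₀-off u e≈0 = trans (sym (e*a₀ u)) (trans (*-congʳ e≈0) (zeroˡ _))

    h≈f : ∀ u → h u ≈ f u
    h≈f u = trans (+-congˡ (-‿cong (trans (f-outside-S₂ x S₂-self) (a₀-off x (A-diag x))))) (x-0≈x (f u))

    a≈a₀ : ∀ u → a u ≈ a₀ u
    a≈a₀ u with S₂-cases x u
    ... | inj₁ t≈0       = trans (*-congˡ (trans (h≈f u) (f-outside-S₂ u t≈0))) (e*a₀ u)
    ... | inj₂ (_ , e≈0) = trans (trans (*-congʳ e≈0) (zeroˡ _)) (sym (a₀-off u e≈0))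

    g≈ : ∀ u → g u ≈ (A · a₀) u
    g≈ u = dot-congˡ {v = A u} a≈a₀

    restrict-f : ∀ i → h (p i) ≈ v i
    restrict-f i = trans (trans (sym (trans (*-congʳ (A-adj (p-adj i))) (*-identityˡ _))) (a≈a₀ (p i))) (a₀-p i)

    R≈0 : R ≈ 0#
    R≈0 = sum-zero _ pointwise
      where
      pointwise : ∀ u → S₂ x u * ((βʳ * h u - fromℕ 2 * g u) * (βʳ * h u - fromℕ 2 * g u)) ≈ 0#
      pointwise u with S₂-cases x u
      ... | inj₁ t≈0         = trans (*-congʳ t≈0) (zeroˡ _)
      ... | inj₂ (t≈1 , e≈0) = trans (*-congˡ (trans (*-congʳ βh-2g≈0) (zeroˡ _))) (zeroʳ _)
        where
        h≈ : h u ≈ fromℕ 2 / βʳ * g u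
        h≈ = trans (h≈f u) (trans (+-cong (a₀-off u e≈0) (trans (*-congʳ t≈1) (*-identityˡ _))) (trans (+-identityˡ _) (*-congˡ (sym (g≈ u)))))
        βh-2g≈0 : βʳ * h u - fromℕ 2 * g u ≈ 0#
        βh-2g≈0 = begin
          βʳ * h u - fromℕ 2 * g u                      ≈⟨ +-congʳ (*-congˡ h≈) ⟩
          βʳ * (fromℕ 2 / βʳ * g u) - fromℕ 2 * g u     ≈⟨ +-congʳ (trans (sym (*-assoc _ _ _)) (*-congʳ (*-/-cancel 0<β (fromℕ 2)))) ⟩
          fromℕ 2 * g u - fromℕ 2 * g u                 ≈⟨ -‿inverseʳ _ ⟩
          0#                                            ∎
          where open ≈-Reasoning

  -- Testing with the constants, respectively with an eigenvector that attains m, bounds 2βK by c₁ ν, respectively c₂ m.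
  c₁ c₂ : Carrier → Carrier
  c₁ ν = (αʳ + fromℕ 4) * βʳ - fromℕ 4 * βʳ * dʳ * ν
  c₂ m = coefficient + fromℕ 4 * m

  module _ (0<β : 0# < βʳ) (2≤d : 2 ℕ.≤ d) (ν : Carrier) where

    -- With `ν` for 1/𝒩, finite and infinite dimension are treated at once.
    CD : Carrier → Set (c ⊔ ℓ₂)
    CD K = ∀ f → ν * (Δ G f x) ² + K * Γ G f f x ≤ Γ₂ G f f x

    0<d : 0# < dʳ
    0<d = <-≤-trans (fromℕ-pos 1) (fromℕ-mono 2≤d)
      where
      fromℕ-mono : ∀ {m n} → m ℕ.≤ n → fromℕ m ≤ fromℕ n
      fromℕ-mono {n = n} z≤n = fromℕ-nonneg n
      fromℕ-mono (s≤s m≤n) = +-mono-≤ ≤-refl (fromℕ-mono m≤n)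

    0<4β : 0# < fromℕ 4 * βʳ
    0<4β = *-pos (fromℕ-pos 3) 0<β

    4β-CD : ∀ K f → let v = Restriction.v f in
      fromℕ 4 * βʳ * (ν * (Δ G f x) ² + K * Γ G f f x) ≈ fromℕ 4 * βʳ * (ν * sum v ²) + fromℕ 2 * βʳ * K * ‖ v ‖²
    4β-CD K f = begin
      fromℕ 4 * βʳ * (ν * (Δ G f x) ² + K * Γ G f f x)
        ≈⟨ solve 5 (λ β ν D K γ → con (+ 4) :* β :* (ν :* (D :* D) :+ K :* γ) := con (+ 4) :* β :* (ν :* (D :* D)) :+ con (+ 2) :* β :* K :* (con (+ 2) :* γ)) refl
             βʳ ν (Δ G f x) K (Γ G f f x) ⟩
      fromℕ 4 * βʳ * (ν * (Δ G f x) ²) + fromℕ 2 * βʳ * K * (fromℕ 2 * Γ G f f x)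
        ≈⟨ +-cong (*-congˡ (*-congˡ (*-cong Δfx Δfx))) (*-congˡ 2Γffx) ⟩
      fromℕ 4 * βʳ * (ν * sum v ²) + fromℕ 2 * βʳ * K * ‖ v ‖² ∎
      where
      open ≈-Reasoning
      open Restriction f

    -- Test the inequality, multiplied by 4β, with the optimal extension of `v`: there R = 0, and
    -- the energy of an eigenvector is a multiple of ‖v‖². It serves both for constants and for
    -- eigenvectors in 𝟏⊥.
    CD-eigenvector : ∀ {K} → CD K → ∀ v θ → (∀ i → (B · v) i ≈ θ * v i) →
      fromℕ 4 * βʳ * (ν * sum v ²) + fromℕ 2 * βʳ * K * ‖ v ‖² ≤
      coefficient * ‖ v ‖² + (fromℕ 4 - fromℕ 2 * βʳ) * sum v ² + (fromℕ 2 * θ - αʳ) ² * ‖ v ‖²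
    CD-eigenvector {K} cd v θ Bv≈θv =
      ≤-respˡ-≈ (trans (4β-CD K f) (+-cong (*-congˡ (*-congˡ (*-cong Σv Σv))) (*-congˡ ‖v‖²)))
        (≤-respʳ-≈ value (*-monoˡ-≤ (<⇒≤ 0<4β) (cd f)))
      where
      open Extension 0<β v using (f; restrict-f; R≈0)
      module Res = Restriction f
      Σv : sum Res.v ≈ sum v
      Σv = sum-cong-≋ restrict-f
      ‖v‖² : ‖ Res.v ‖² ≈ ‖ v ‖²
      ‖v‖² = dot-cong {v = Res.v} restrict-f restrict-f
      energy-v : energy Res.v ≈ (fromℕ 2 * θ - αʳ) ² * ‖ v ‖²
      energy-v = trans (sum-cong-≋ λ i → trans (*-cong (entry i) (entry i))
          (solve 3 (λ θ α v → (con (+ 2) :* (θ :* v) :- α :* v) :* (con (+ 2) :* (θ :* v) :- α :* v) :=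
            (con (+ 2) :* θ :- α) :* (con (+ 2) :* θ :- α) :* (v :* v)) refl θ αʳ (v i)))
        (sym (*-distribˡ-sum ((fromℕ 2 * θ - αʳ) ²) (λ i → v i * v i)))
        where
        entry : ∀ i → fromℕ 2 * (B · Res.v) i - αʳ * Res.v i ≈ fromℕ 2 * (θ * v i) - αʳ * v i
        entry i = +-cong (*-congˡ (trans (dot-congˡ {v = B i} restrict-f) (Bv≈θv i))) (-‿cong (*-congˡ (restrict-f i)))
      value : fromℕ 4 * βʳ * Γ₂ G f f x ≈ coefficient * ‖ v ‖² + (fromℕ 4 - fromℕ 2 * βʳ) * sum v ² + (fromℕ 2 * θ - αʳ) ² * ‖ v ‖²
      value = trans Res.4βΓ₂ (+-cong (+-cong (trans (+-congʳ R≈0) (trans (+-identityˡ _) (*-congˡ ‖v‖²))) (*-congˡ (*-cong Σv Σv))) energy-v)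

    ‖1‖² : sum {k} (λ _ → fromℕ 1) ≈ dʳ
    ‖1‖² = trans (sum-cong-≋ {x = λ (_ : Fin k) → fromℕ 1} {λ _ → 1#} λ _ → +-identityʳ 1#) (trans (sum-one {k}) fromℕ-k)

    -- The constants form an eigenvector for α with ‖1‖² = Σ1 = d. After division by d, the energy
    -- α² cancels -α² in `coefficient`, and (4 - 2β)d cancels 2dβ - 4d, which leaves (α + 4)β.
    CD⇒≤c₁ : ∀ {K} → CD K → fromℕ 2 * βʳ * K ≤ c₁ ν
    CD⇒≤c₁ {K} cd = *-cancelˡ-≤ 0<d (≤-by (x≤y⇒0≤y-x (≤-respˡ-≈ lhs (≤-respʳ-≈ rhs (CD-eigenvector cd (λ _ → fromℕ 1) αʳ Bone))))
      (solve 5 (λ α β d ν K → let coeff = (α :+ con (+ 2) :* d :+ con (+ 4)) :* β :- con (+ 4) :* d :- α :* α in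
         d :* ((α :+ con (+ 4)) :* β :- con (+ 4) :* β :* d :* ν) := d :* (con (+ 2) :* β :* K) :+
         (coeff :* d :+ (con (+ 4) :- con (+ 2) :* β) :* (d :* d) :+ (con (+ 2) :* α :- α) :* (con (+ 2) :* α :- α) :* d
          :- (con (+ 4) :* β :* (ν :* (d :* d)) :+ con (+ 2) :* β :* K :* d))) refl αʳ βʳ dʳ ν K))
      where
      one : Vector Carrier k
      one _ = fromℕ 1
      Bone : ∀ i → (B · one) i ≈ αʳ * fromℕ 1
      Bone i = trans (sym (*-distribʳ-sum (fromℕ 1) (B i))) (*-congʳ (B-rows i))
      ‖one‖² : ‖ one ‖² ≈ dʳ
      ‖one‖² = trans (sum-cong-≋ {x = λ i → one i * one i} {one} λ _ → solve 0 (con (+ 1) :* con (+ 1) := con (+ 1)) refl) ‖1‖²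
      lhs : fromℕ 4 * βʳ * (ν * sum one ²) + fromℕ 2 * βʳ * K * ‖ one ‖² ≈ fromℕ 4 * βʳ * (ν * dʳ ²) + fromℕ 2 * βʳ * K * dʳ
      lhs = +-cong (*-congˡ (*-congˡ (*-cong ‖1‖² ‖1‖²))) (*-congˡ ‖one‖²)
      rhs : coefficient * ‖ one ‖² + (fromℕ 4 - fromℕ 2 * βʳ) * sum one ² + (fromℕ 2 * αʳ - αʳ) ² * ‖ one ‖² ≈
            coefficient * dʳ + (fromℕ 4 - fromℕ 2 * βʳ) * dʳ ² + (fromℕ 2 * αʳ - αʳ) ² * dʳ
      rhs = +-cong (+-cong (*-congˡ ‖one‖²) (*-congˡ (*-cong ‖1‖² ‖1‖²))) (*-congˡ ‖one‖²)

    -- On 𝟏⊥ the terms with Σv vanish, including the one with ν, so this bound does not depend on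
    -- the dimension.
    CD⇒≤c₂ : ∀ {K} → CD K → ∀ {θ} → σ B 𝟏⊥ θ → ∀ {m} → fromℕ 4 * m ≈ (fromℕ 2 * θ - αʳ) ² → fromℕ 2 * βʳ * K ≤ c₂ m
    CD⇒≤c₂ {K} cd {θ} (v , Σv≈0 , v≉0 , Bv≈θv) {m} 4m≈ = *-cancelˡ-≤ (‖‖²-pos v v≉0)
      (≤-respˡ-≈ lhs (≤-respʳ-≈ rhs (CD-eigenvector cd v θ Bv≈θv)))
      where
      Σv²≈0 : sum v ² ≈ 0#
      Σv²≈0 = trans (*-congʳ Σv≈0) (zeroˡ _)
      lhs : fromℕ 4 * βʳ * (ν * sum v ²) + fromℕ 2 * βʳ * K * ‖ v ‖² ≈ ‖ v ‖² * (fromℕ 2 * βʳ * K)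
      lhs = trans (+-congʳ (*-congˡ (*-congˡ Σv²≈0)))
        (solve 4 (λ β ν K n → con (+ 4) :* β :* (ν :* con (+ 0)) :+ con (+ 2) :* β :* K :* n := n :* (con (+ 2) :* β :* K)) refl βʳ ν K (‖ v ‖²))
      rhs : coefficient * ‖ v ‖² + (fromℕ 4 - fromℕ 2 * βʳ) * sum v ² + (fromℕ 2 * θ - αʳ) ² * ‖ v ‖² ≈ ‖ v ‖² * c₂ m
      rhs = trans (+-cong (+-congˡ (*-congˡ Σv²≈0)) (*-congʳ (sym 4m≈)))
        (solve 4 (λ C β n m → C :* n :+ (con (+ 4) :- con (+ 2) :* β) :* con (+ 0) :+ con (+ 4) :* m :* n := n :* (C :+ con (+ 4) :* m)) refl coefficient βʳ (‖ v ‖²) m)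

    module _ {m : Carrier} {η : Carrier} (2η≈α : fromℕ 2 * η ≈ αʳ)
      (m-bound : ∀ w → 𝟏⊥ w → m * ‖ w ‖² ≤ sum (λ i → ((B · w) i - η * w i) ²)) where

      -- Split v = w + s·1 with s the mean value, so w lies in 𝟏⊥ and q = ‖w‖². Then (2B - α)v = 2(B
      -- - η)w + sα·1, and the two parts are orthogonal because B preserves 𝟏⊥. The first has square
      -- norm at least 4mq, the second exactly α²s²d.
      energy-bound : ∀ v → ∃ λ q → ∃ λ s → 0# ≤ q × sum v ≈ s * dʳ × ‖ v ‖² ≈ q + s * s * dʳ ×
                     fromℕ 4 * m * q + αʳ * αʳ * (s * s * dʳ) ≤ energy v
      energy-bound v = ‖ w ‖² , s , ‖‖²-nonneg w , Σv≈sd , ‖v‖² , ≤-by 0≤slack energy-v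
        where
        s : Carrier
        s = sum v / dʳ
        w : Vector Carrier k
        w = comb (fromℕ 1) v (- s) (λ _ → fromℕ 1)
        z : Vector Carrier k
        z i = (B · w) i - η * w i
        Σv≈sd : sum v ≈ s * dʳ
        Σv≈sd = trans (sym (*-/-cancel 0<d (sum v))) (*-comm dʳ s)
        Σw≈0 : sum w ≈ 0#
        Σw≈0 = trans (trans (sum-linear (fromℕ 1) v (- s) (λ _ → fromℕ 1)) (+-congˡ (*-congˡ ‖1‖²)))
          (modulo {k = fromℕ 1} Σv≈sd (solve 3 (λ S s d → con (+ 1) :* S :+ (:- s) :* d := con (+ 0) :+ con (+ 1) :* (S :- s :* d)) refl (sum v) s dʳ))
        v-split : ∀ i → v i ≈ w i + s * fromℕ 1
        v-split i = solve 2 (λ v s → v := con (+ 1) :* v :+ (:- s) :* con (+ 1) :+ s :* con (+ 1)) refl (v i) s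
        ‖v‖² : ‖ v ‖² ≈ ‖ w ‖² + s * s * dʳ
        ‖v‖² = begin
          ‖ v ‖²
            ≈⟨ sum-linear₃ {p = λ i → w i * w i} {w} {λ _ → fromℕ 1} {fromℕ 1} {fromℕ 2 * s} {s * s} (λ i → trans (*-cong (v-split i) (v-split i))
                 (solve 2 (λ w s → (w :+ s :* con (+ 1)) :* (w :+ s :* con (+ 1)) := con (+ 1) :* (w :* w) :+ con (+ 2) :* s :* w :+ s :* s :* con (+ 1)) refl (w i) s)) ⟩
          fromℕ 1 * ‖ w ‖² + fromℕ 2 * s * sum w + s * s * sum {k} (λ _ → fromℕ 1)
            ≈⟨ +-cong (+-congˡ (*-congˡ Σw≈0)) (*-congˡ ‖1‖²) ⟩
          fromℕ 1 * ‖ w ‖² + fromℕ 2 * s * 0# + s * s * dʳ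
            ≈⟨ solve 3 (λ q s d → con (+ 1) :* q :+ con (+ 2) :* s :* con (+ 0) :+ s :* s :* d := q :+ s :* s :* d) refl (‖ w ‖²) s dʳ ⟩
          ‖ w ‖² + s * s * dʳ ∎
          where open ≈-Reasoning
        B·v : ∀ i → (B · v) i ≈ (B · w) i + s * αʳ
        B·v i = begin
          (B · v) i
            ≈⟨ sum-linear₃ {p = λ j → B i j * w j} {B i} {B i} {fromℕ 1} {s} {0#} (λ j → trans (*-congˡ (v-split j))
                 (solve 3 (λ b w s → b :* (w :+ s :* con (+ 1)) := con (+ 1) :* (b :* w) :+ s :* b :+ con (+ 0) :* b) refl (B i j) (w j) s)) ⟩
          fromℕ 1 * (B · w) i + s * sum (B i) + 0# * sum (B i)
            ≈⟨ +-congʳ (+-congˡ (*-congˡ (B-rows i))) ⟩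
          fromℕ 1 * (B · w) i + s * αʳ + 0# * sum (B i)
            ≈⟨ solve 4 (λ b s α r → con (+ 1) :* b :+ s :* α :+ con (+ 0) :* r := b :+ s :* α) refl ((B · w) i) s αʳ (sum (B i)) ⟩
          (B · w) i + s * αʳ ∎
          where open ≈-Reasoning
        entry : ∀ i → fromℕ 2 * (B · v) i - αʳ * v i ≈ fromℕ 2 * z i + s * αʳ
        entry i = trans (+-cong (*-congˡ (B·v i)) (-‿cong (*-congˡ (v-split i))))
          (modulo {k = w i} 2η≈α (solve 5 (λ b s α w η → con (+ 2) :* (b :+ s :* α) :- α :* (w :+ s :* con (+ 1)) :=
            con (+ 2) :* (b :- η :* w) :+ s :* α :+ w :* (con (+ 2) :* η :- α)) refl ((B · w) i) s αʳ (w i) η))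
        Σz≈0 : sum z ≈ 0#
        Σz≈0 = begin
          sum z
            ≈⟨ sum-linear₃ {p = B · w} {w} {w} {fromℕ 1} { - η} {0#} (λ i → solve 3 (λ b η w → b :- η :* w := con (+ 1) :* b :+ (:- η) :* w :+ con (+ 0) :* w) refl ((B · w) i) η (w i)) ⟩
          fromℕ 1 * sum (B · w) + - η * sum w + 0# * sum w
            ≈⟨ +-cong (+-cong (*-congˡ (trans (sum-· B B-sym B-rows w) (*-congˡ Σw≈0))) (*-congˡ Σw≈0)) (*-congˡ Σw≈0) ⟩
          fromℕ 1 * (αʳ * 0#) + - η * 0# + 0# * 0#
            ≈⟨ solve 2 (λ α η → con (+ 1) :* (α :* con (+ 0)) :+ (:- η) :* con (+ 0) :+ con (+ 0) :* con (+ 0) := con (+ 0)) refl αʳ η ⟩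
          0# ∎
          where open ≈-Reasoning
        0≤slack : 0# ≤ fromℕ 4 * (‖ z ‖² - m * ‖ w ‖²)
        0≤slack = fromℕ-nonneg 4 ⊗ x≤y⇒0≤y-x (m-bound w Σw≈0)
        energy-v : energy v ≈ fromℕ 4 * m * ‖ w ‖² + αʳ * αʳ * (s * s * dʳ) + fromℕ 4 * (‖ z ‖² - m * ‖ w ‖²)
        energy-v = begin
          energy v
            ≈⟨ sum-linear₃ {p = λ i → z i * z i} {z} {λ _ → fromℕ 1} {fromℕ 4} {fromℕ 4 * (s * αʳ)} {s * αʳ * (s * αʳ)} (λ i → trans (*-cong (entry i) (entry i))
                 (solve 3 (λ z s α → (con (+ 2) :* z :+ s :* α) :* (con (+ 2) :* z :+ s :* α) :=
                    con (+ 4) :* (z :* z) :+ con (+ 4) :* (s :* α) :* z :+ s :* α :* (s :* α) :* con (+ 1)) refl (z i) s αʳ)) ⟩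
          fromℕ 4 * ‖ z ‖² + fromℕ 4 * (s * αʳ) * sum z + s * αʳ * (s * αʳ) * sum {k} (λ _ → fromℕ 1)
            ≈⟨ +-cong (+-congˡ (*-congˡ Σz≈0)) (*-congˡ ‖1‖²) ⟩
          fromℕ 4 * ‖ z ‖² + fromℕ 4 * (s * αʳ) * 0# + s * αʳ * (s * αʳ) * dʳ
            ≈⟨ solve 6 (λ Z s α d m q → con (+ 4) :* Z :+ con (+ 4) :* (s :* α) :* con (+ 0) :+ s :* α :* (s :* α) :* d :=
                 con (+ 4) :* m :* q :+ α :* α :* (s :* s :* d) :+ con (+ 4) :* (Z :- m :* q)) refl (‖ z ‖²) s αʳ dʳ m (‖ w ‖²) ⟩
          fromℕ 4 * m * ‖ w ‖² + αʳ * αʳ * (s * s * dʳ) + fromℕ 4 * (‖ z ‖² - m * ‖ w ‖²) ∎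
          where open ≈-Reasoning

      -- In the orthogonal splitting of v, 4β times the difference of the two sides is R + s²d(c₁ -
      -- 2βK) + q(c₂ - 2βK) plus the excess in `energy-bound`, and each summand is nonnegative.
      ≤c₁,c₂⇒CD : ∀ {K} → fromℕ 2 * βʳ * K ≤ c₁ ν → fromℕ 2 * βʳ * K ≤ c₂ m → CD K
      ≤c₁,c₂⇒CD {K} ≤c₁ ≤c₂ f = *-cancelˡ-≤ 0<4β
        (≤-respˡ-≈ (sym lhs) (≤-respʳ-≈ (sym 4βΓ₂) (≤-by 0≤slack equation)))
        where
        open Restriction f
        bound = energy-bound v
        q = proj₁ bound
        s = proj₁ (proj₂ bound)
        0≤q = proj₁ (proj₂ (proj₂ bound))
        Σv≈ = proj₁ (proj₂ (proj₂ (proj₂ bound)))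
        ‖v‖²≈ = proj₁ (proj₂ (proj₂ (proj₂ (proj₂ bound))))
        energy≥ = proj₂ (proj₂ (proj₂ (proj₂ (proj₂ bound))))
        R = At.R x f
        X = fromℕ 2 * βʳ * K
        sd = s * dʳ
        ssd = s * s * dʳ
        lhs : fromℕ 4 * βʳ * (ν * (Δ G f x) ² + K * Γ G f f x) ≈ fromℕ 4 * βʳ * (ν * sd ²) + X * (q + ssd)
        lhs = trans (4β-CD K f) (+-cong (*-congˡ (*-congˡ (*-cong Σv≈ Σv≈))) (*-congˡ ‖v‖²≈))
        slack = R + ssd * (c₁ ν - X) + q * (c₂ m - X) + (energy v - (fromℕ 4 * m * q + αʳ * αʳ * ssd))
        0≤slack : 0# ≤ slack
        0≤slack = 0≤R ⊕ (²-nonneg s ⊗ <⇒≤ 0<d) ⊗ x≤y⇒0≤y-x ≤c₁ ⊕ 0≤q ⊗ x≤y⇒0≤y-x ≤c₂ ⊕ x≤y⇒0≤y-x energy≥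
        equation : R + coefficient * ‖ v ‖² + (fromℕ 4 - fromℕ 2 * βʳ) * sum v ² + energy v ≈
                   fromℕ 4 * βʳ * (ν * sd ²) + X * (q + ssd) + slack
        equation = trans (+-congʳ (+-cong (+-congˡ (*-congˡ ‖v‖²≈)) (*-congˡ (*-cong Σv≈ Σv≈)))) (begin
          R + coefficient * (q + ssd) + (fromℕ 4 - fromℕ 2 * βʳ) * sd ² + energy v
            ≈⟨ solve 7 (λ R C q P β D E → R :+ C :* (q :+ P) :+ (con (+ 4) :- con (+ 2) :* β) :* D :+ E :=
                 C :* P :+ (con (+ 4) :- con (+ 2) :* β) :* D :+ (C :* q :+ (R :+ E))) refl R coefficient q ssd βʳ (sd ²) (energy v) ⟩
          coefficient * ssd + (fromℕ 4 - fromℕ 2 * βʳ) * sd ² + (coefficient * q + (R + energy v))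
            -- The constant part of v yields s²d·c₁ up to -α²s²d, which is made up for by the
            -- constant part of the energy.
            ≈⟨ +-congʳ (solve 5 (λ α β d s ν →
                 ((α :+ con (+ 2) :* d :+ con (+ 4)) :* β :- con (+ 4) :* d :- α :* α) :* (s :* s :* d) :+ (con (+ 4) :- con (+ 2) :* β) :* (s :* d :* (s :* d)) :=
                 s :* s :* d :* ((α :+ con (+ 4)) :* β :- con (+ 4) :* β :* d :* ν) :+ con (+ 4) :* β :* (ν :* (s :* d :* (s :* d))) :- α :* α :* (s :* s :* d))
                 refl αʳ βʳ dʳ s ν) ⟩
          ssd * c₁ ν + fromℕ 4 * βʳ * (ν * sd ²) - αʳ * αʳ * ssd + (coefficient * q + (R + energy v))
            ≈⟨ solve 10 (λ P c₁ W αα C q R E X m →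
                 P :* c₁ :+ W :- αα :* P :+ (C :* q :+ (R :+ E)) :=
                 W :+ X :* (q :+ P) :+ (R :+ P :* (c₁ :- X) :+ q :* (C :+ con (+ 4) :* m :- X) :+ (E :- (con (+ 4) :* m :* q :+ αα :* P))))
                 refl ssd (c₁ ν) (fromℕ 4 * βʳ * (ν * sd ²)) (αʳ * αʳ) coefficient q R (energy v) X m ⟩
          fromℕ 4 * βʳ * (ν * sd ²) + X * (q + ssd) + slack ∎)
          where open ≈-Reasoning

-- The curvature formula

theorem11p1 :
    ∀ {c ℓ₁ ℓ₂} (ℝ : CompleteOrderedField c ℓ₁ ℓ₂) →
    let open CompleteOrderedField ℝ
        open OverReals ℝ
    in
    ∀ {N d α β : ℕ} (G : SimpleGraph N) → IsStronglyRegular G d α β → 1 ≤ℕ β →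
    (x : Fin N) (𝒩 : Dimension) →
    ∃ λ m →
      IsMinimum
        (λ s → ∃ λ θ → σ (adjacencyMatrix (induced G (S₁ G x))) 𝟏⊥ θ ×
                       s ≈ (θ - fromℕ α / fromℕ 2) ²)
        m
      ×
      IsBakryEmeryCurvature G x 𝒩
        (fromℕ 2 + fromℕ α / fromℕ 2 - fromℕ 2 * fromℕ d * (1/ 𝒩)
          + ( (fromℕ 2 * fromℕ d * (fromℕ β - fromℕ 2) - (fromℕ α) ²)
                / (fromℕ 2 * fromℕ β)
            + fromℕ 2 * fromℕ d * (1/ 𝒩)
            + fromℕ 2 / fromℕ β * m
            ) ₋)
theorem11p1 {c} {ℓ₁} {ℓ₂} ℝ {N} {d} {α} {suc β′} G srg 1≤β x 𝒩 = m , minimum , ≤c₁,c₂⇒CD 0<β 2≤d ν 2η≈α m-bound K≤c₁ K≤c₂ , upper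
  where
  open CompleteOrderedField ℝ hiding (zero)
  open OverReals ℝ
  open OrderedField ℝ
  open Sums ℝ
  open ShiftedSpectrum ℝ
  open Neighbourhood ℝ G srg x
  open StronglyRegular ℝ G srg using (dʳ; αʳ; βʳ)
  open Algebra.Construct.NaturalChoice.Min (DecTotalOrder.totalOrder decTotalOrder) using (x⊓y≤x; x⊓y≤y; ⊓-glb)

  ν η : Carrier
  ν = 1/ 𝒩
  η = αʳ / fromℕ 2

  2≤d = 2≤degree G srg 1≤β

  0<β : 0# < βʳ
  0<β = fromℕ-pos β′

  abstract
    least : ∃ λ m → IsMinimum (λ s → ∃ λ θ → σ B 𝟏⊥ θ × s ≈ (θ - η) ²) m ×
                    (∀ w → 𝟏⊥ w → m * ‖ w ‖² ≤ sum (λ i → ((B · w) i - η * w i) ²))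
    least = least-shifted-eigenvalue (≡.subst (2 ≤ℕ_) (≡.sym (IsStronglyRegular.regular srg x)) 2≤d) B B-sym B-rows η

  m = proj₁ least
  minimum = proj₁ (proj₂ least)
  m-bound = proj₂ (proj₂ least)

  2η≈α : fromℕ 2 * η ≈ αʳ
  2η≈α = *-/-cancel (fromℕ-pos 1) αʳ

  0<2β : 0# < fromℕ 2 * βʳ
  0<2β = *-pos (fromℕ-pos 1) 0<β

  -- With 2βK₁ = c₁ and 2β(K₁ + D) = c₂, the number K₁ + min{0, D} is the smaller of c₁/(2β) and
  -- c₂/(2β).
  numerator K₁ D : Carrier
  numerator = fromℕ 2 * dʳ * (βʳ - fromℕ 2) - αʳ ²
  K₁ = fromℕ 2 + η - fromℕ 2 * dʳ * ν
  D  = numerator / (fromℕ 2 * βʳ) + fromℕ 2 * dʳ * ν + fromℕ 2 / βʳ * m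

  2βK₁≈c₁ : fromℕ 2 * βʳ * K₁ ≈ c₁ ν
  2βK₁≈c₁ = modulo {k = βʳ} 2η≈α (solve 5 (λ α β d ν η →
    con (+ 2) :* β :* (con (+ 2) :+ η :- con (+ 2) :* d :* ν) :=
    (α :+ con (+ 4)) :* β :- con (+ 4) :* β :* d :* ν :+ β :* (con (+ 2) :* η :- α)) refl αʳ βʳ dʳ ν η)

  2βD≈c₂-c₁ : fromℕ 2 * βʳ * D ≈ c₂ m - c₁ ν
  2βD≈c₂-c₁ = begin
    fromℕ 2 * βʳ * D
      ≈⟨ solve 6 (λ β F d ν κ m → con (+ 2) :* β :* (F :+ con (+ 2) :* d :* ν :+ κ :* m) :=
           con (+ 2) :* β :* F :+ con (+ 4) :* β :* d :* ν :+ con (+ 2) :* (β :* κ) :* m) refl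
           βʳ (numerator / (fromℕ 2 * βʳ)) dʳ ν (fromℕ 2 / βʳ) m ⟩
    fromℕ 2 * βʳ * (numerator / (fromℕ 2 * βʳ)) + fromℕ 4 * βʳ * dʳ * ν + fromℕ 2 * (βʳ * (fromℕ 2 / βʳ)) * m
      ≈⟨ +-cong (+-congʳ (*-/-cancel 0<2β numerator)) (*-congʳ (*-congˡ (*-/-cancel 0<β (fromℕ 2)))) ⟩
    numerator + fromℕ 4 * βʳ * dʳ * ν + fromℕ 2 * fromℕ 2 * m
      ≈⟨ solve 5 (λ α β d ν m →
           con (+ 2) :* d :* (β :- con (+ 2)) :- α :* α :+ con (+ 4) :* β :* d :* ν :+ con (+ 2) :* con (+ 2) :* m :=
           (α :+ con (+ 2) :* d :+ con (+ 4)) :* β :- con (+ 4) :* d :- α :* α :+ con (+ 4) :* m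
           :- ((α :+ con (+ 4)) :* β :- con (+ 4) :* β :* d :* ν)) refl αʳ βʳ dʳ ν m ⟩
    c₂ m - c₁ ν ∎
    where open ≈-Reasoning

  2β[K₁+D]≈c₂ : fromℕ 2 * βʳ * (K₁ + D) ≈ c₂ m
  2β[K₁+D]≈c₂ = trans (distribˡ _ K₁ D) (trans (+-cong 2βK₁≈c₁ 2βD≈c₂-c₁)
    (solve 2 (λ p q → p :+ (q :- p) := q) refl (c₁ ν) (c₂ m)))

  K≤c₁ : fromℕ 2 * βʳ * (K₁ + D ₋) ≤ c₁ ν
  K≤c₁ = ≤-respʳ-≈ 2βK₁≈c₁ (*-monoˡ-≤ (<⇒≤ 0<2β) (≤-respʳ-≈ (+-identityʳ K₁) (+-mono-≤ ≤-refl (x⊓y≤x 0# D))))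

  K≤c₂ : fromℕ 2 * βʳ * (K₁ + D ₋) ≤ c₂ m
  K≤c₂ = ≤-respʳ-≈ 2β[K₁+D]≈c₂ (*-monoˡ-≤ (<⇒≤ 0<2β) (+-mono-≤ ≤-refl (x⊓y≤y 0# D)))

  4m≈ : ∀ {θ} → m ≈ (θ - η) ² → fromℕ 4 * m ≈ (fromℕ 2 * θ - αʳ) ²
  4m≈ {θ} m≈ = trans (*-congˡ m≈) (trans
    (solve 2 (λ θ η → con (+ 4) :* ((θ :- η) :* (θ :- η)) := (con (+ 2) :* θ :- con (+ 2) :* η) :* (con (+ 2) :* θ :- con (+ 2) :* η)) refl θ η)
    (*-cong (+-congˡ (-‿cong 2η≈α)) (+-congˡ (-‿cong 2η≈α))))

  upper : ∀ {K} → CurvatureDimension G x 𝒩 K → K ≤ K₁ + D ₋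
  upper {K} cd = ≤-respˡ-≈ (solve 2 (λ K K₁ → K₁ :+ (K :- K₁) := K) refl K K₁) (+-mono-≤ ≤-refl
    (⊓-glb (0≤y-x⇒x≤y (≤-respʳ-≈ (solve 2 (λ K K₁ → K₁ :- K := con (+ 0) :- (K :- K₁)) refl K K₁) (x≤y⇒0≤y-x K≤K₁)))
           (0≤y-x⇒x≤y (≤-respʳ-≈ (solve 3 (λ K K₁ D → K₁ :+ D :- K := D :- (K :- K₁)) refl K K₁ D) (x≤y⇒0≤y-x K≤K₁+D)))))
    where
    attained = proj₁ minimum
    K≤K₁ : K ≤ K₁
    K≤K₁ = *-cancelˡ-≤ 0<2β (≤-respʳ-≈ (sym 2βK₁≈c₁) (CD⇒≤c₁ 0<β 2≤d ν cd))
    K≤K₁+D : K ≤ K₁ + D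
    K≤K₁+D = *-cancelˡ-≤ 0<2β (≤-respʳ-≈ (sym 2β[K₁+D]≈c₂)
      (CD⇒≤c₂ 0<β 2≤d ν cd (proj₁ (proj₂ attained)) (4m≈ (proj₂ (proj₂ attained)))))
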